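{- Let $\mathcal{K}^2=(K_1\Box K_1,\ldots,K_n\Box K_n,\ldots)$ be the sequence of Cartesian squares of complete graphs, and let $N=N(n)=n^2$ denote the number of vertices of its $n$-th member $K_n\Box K_n$. Then the pebbling threshold of $\mathcal{K}^2$ is $$\tau_{\mathcal{K}^2}=\Theta(\sqrt{N}),$$ i.e., a positive function $f=f(n)$ is a pebbling threshold for $\mathcal{K}^2$ if and only if $f\in\Theta(\sqrt{N})=\Theta(n)$.
   Context: Pebbling. A configuration $C$ of $t$ pebbles on a connected graph $G$ is a placement of $t$ indistinguishable pebbles on the vertices of $G$, i.e. a function $C:V(G)\to\mathbb{Z}_{\ge 0}$ with $\sum_v C(v)=t$. A pebbling step from $u$ to an adjacent vertex $v$ removes two pebbles from $u$ and places one pebble on $v$. $C$ is $r$-solvable if, after finitely many (possibly zero) pebbling steps, the vertex $r$ has at least one pebble. $C$ is solvable if it is $r$-solvable for every vertex $r$. Cartesian product. $G_1\Box G_2$ has vertex set $V(G_1)\times V(G_2)$, with $(v_1,v_2)$ adjacent to $(w_1,w_2)$ iff either $v_1=w_1$ and $v_2w_2\in E(G_2)$, or $v_2=w_2$ and $v_1w_1\in E(G_1)$. Random configurations and threshold. For a graph sequence $\mathcal{G}=(G_1,G_2,\ldots)$, let $N_n=|V(G_n)|$. Let $P_{\mathcal{G}}(n,t)$ be the probability that a configuration of $t$ pebbles on $G_n$, chosen uniformly at random from all $\binom{N_n+t-1}{t}$ configurations of $t$ (unlabeled) pebbles on $V(G_n)$, is solvable. For functions of $n$, $f\ll g$ (equivalently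 $g\gg f$) means $\lim_{n\to\infty} f(n)/g(n)=0$; $f\in O(g)$ (equivalently $g\in\Omega(f)$) means there are positive constants $c,k$ with $f(n)/g(n)<c$ for all $n>k$; $\Theta(g)=O(g)\cap\Omega(g)$. A function $f=f(n)$ is a (pebbling) threshold for $\mathcal{G}$, written $f\in\tau_{\mathcal{G}}$, if $P_{\mathcal{G}}(n,t)\to 1$ as $n\to\infty$ for every (nonnegative-integer-valued) $t=t(n)$ with $t\gg f$, and $P_{\mathcal{G}}(n,t)\to 0$ as $n\to\infty$ for every $t=t(n)$ with $t\ll f$. -}

module Defs where

open import Data.Nat.Base as ℕ using (ℕ; zero; suc; z≤n; s≤s)
import Data.Nat.Properties as ℕ
open import Data.Nat.Induction using (<-wellFounded)
open import Data.Integer.Base using (+_)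
open import Data.Rational as ℚ
  using (ℚ; 0ℚ; 1ℚ; _+_; _*_; -_; 1/_; _-_; ∣_∣; Positive; NonNegative; positive; nonNegative; _/_)
import Data.Rational.Properties as ℚ
open import Data.Rational.Literals using (fromℤ)
open import Data.Rational.Solver using (module +-*-Solver)
open import Data.Fin.Base using (Fin; zero; suc; remQuot)
open import Data.Fin.Properties as Fin using (all?; any?)
open import Data.List.Base using (List; []; _∷_; map; _++_; length; filter)
open import Data.List.Membership.Propositional using (_∈_)
open import Data.List.Membership.Propositional.Properties using (∈-map⁺; ∈-map⁻; ∈-++⁺ˡ; ∈-++⁺ʳ; ∈-++⁻)
open import Data.List.Relation.Unary.Any using (here)
open import Data.List.Relation.Unary.All using ([])
open import Data.List.Relation.Unary.AllPairs using ([]; _∷_)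
open import Data.List.Relation.Unary.Unique.Propositional using (Unique)
import Data.List.Relation.Unary.Unique.Propositional.Properties as Unique
open import Data.Vec.Base using (Vec; []; _∷_; lookup; updateAt; sum)
open import Data.Product using (_×_; _,_; proj₁; proj₂; ∃; ∃-syntax; Σ-syntax)
open import Data.Sum.Base using (_⊎_; inj₁; inj₂)
open import Function.Base using (_∘_; case_of_)
open import Function.Bundles using (_⇔_; mk⇔)
open import Induction.WellFounded using (Acc; acc)
open import Relation.Binary.Core using (Rel)
open import Relation.Binary.Definitions using (Decidable; Symmetric; Irreflexive; tri<; tri≈; tri>)
open import Relation.Binary.Construct.Closure.ReflexiveTransitive using (Star; ε; _◅_)
open import Relation.Binary.PropositionalEquality
  using (_≡_; _≢_; refl; sym; trans; cong; cong₂; subst; subst₂)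
open import Relation.Nullary using (¬_; Dec; yes; no; ¬?; _×-dec_; _⊎-dec_; contradiction)
import Relation.Nullary.Decidable as Dec
open import Level using (0ℓ)

record ℝ : Set₁ where
  field
    lower upper   : ℚ → Set
    lower-inhab   : ∃ lower
    upper-inhab   : ∃ upper
    lower-rounded : ∀ {p} → lower p ⇔ (∃[ q ] p ℚ.< q × lower q)
    upper-rounded : ∀ {q} → upper q ⇔ (∃[ p ] p ℚ.< q × upper p)
    disjoint      : ∀ {q} → ¬ (lower q × upper q)
    located       : ∀ {p q} → p ℚ.< q → lower p ⊎ upper q

open ℝ

infix 4 _<_

_<_ : ℝ → ℝ → Set
x < y = ∃[ q ] upper x q × lower y q

fromℚ : ℚ → ℝ
fromℚ a = record
  { lower         = ℚ._< a
  ; upper         = a ℚ.<_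
  ; lower-inhab   = a - 1ℚ , subst (a - 1ℚ ℚ.<_) (ℚ.+-identityʳ a) (ℚ.+-monoʳ-< a (ℚ.negative⁻¹ (- 1ℚ)))
  ; upper-inhab   = a + 1ℚ , subst (ℚ._< a + 1ℚ) (ℚ.+-identityʳ a) (ℚ.+-monoʳ-< a (ℚ.positive⁻¹ 1ℚ))
  ; lower-rounded = mk⇔ ℚ.<-dense (λ (_ , p<q , q<a) → ℚ.<-trans p<q q<a)
  ; upper-rounded = mk⇔ (λ a<q → case ℚ.<-dense a<q of λ (m , a<m , m<q) → m , m<q , a<m)
                        (λ (_ , p<q , a<p) → ℚ.<-trans a<p p<q)
  ; disjoint      = λ (q<a , a<q) → ℚ.<-asym q<a a<q
  ; located       = λ {p} {q} p<q → case ℚ.<-cmp p a of λ where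
      (tri< p<a _ _)  → inj₁ p<a
      (tri≈ _ refl _) → inj₂ p<q
      (tri> _ _ a<p)  → inj₂ (ℚ.<-trans a<p p<q)
  }

fromℕ : ℕ → ℝ
fromℕ n = fromℚ (fromℤ (+ n))

infixr 7 _·_

_·_ : (c : ℚ) .{{_ : Positive c}} → ℝ → ℝ
c · x = record
  { lower         = λ q → lower x (q * i)
  ; upper         = λ q → upper x (q * i)
  ; lower-inhab   = case lower-inhab x of λ (p , lp) → p * c , subst (lower x) (sym (*c*i p)) lp
  ; upper-inhab   = case upper-inhab x of λ (p , up) → p * c , subst (upper x) (sym (*c*i p)) up
  ; lower-rounded = mk⇔
      (λ {lp → case to (lower-rounded x) lp of λ (s , p<s , ls) →
        s * c , subst (ℚ._< s * c) (*i*c _) (ℚ.*-monoˡ-<-pos c p<s) , subst (lower x) (sym (*c*i s)) ls})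
      (λ (q , p<q , lq) → from (lower-rounded x) (q * i , ℚ.*-monoˡ-<-pos i p<q , lq))
  ; upper-rounded = mk⇔
      (λ {uq → case to (upper-rounded x) uq of λ (s , s<q , us) →
        s * c , subst (s * c ℚ.<_) (*i*c _) (ℚ.*-monoˡ-<-pos c s<q) , subst (upper x) (sym (*c*i s)) us})
      (λ (p , p<q , up) → from (upper-rounded x) (p * i , ℚ.*-monoˡ-<-pos i p<q , up))
  ; disjoint      = disjoint x
  ; located       = λ p<q → located x (ℚ.*-monoˡ-<-pos i p<q)
  }
  where
  open Function.Bundles.Equivalence using (to; from)

  instance
    c≢0 : ℚ.NonZero c
    c≢0 = ℚ.pos⇒nonZero c

  i : ℚ
  i = 1/ c

  instance
    i>0 : Positive i
    i>0 = ℚ.1/pos⇒pos c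

  *c*i : ∀ p → p * c * i ≡ p
  *c*i p = trans (ℚ.*-assoc p c i) (trans (cong (p *_) (ℚ.*-inverseʳ c)) (ℚ.*-identityʳ p))

  *i*c : ∀ p → p * i * c ≡ p
  *i*c p = trans (ℚ.*-assoc p i c) (trans (cong (p *_) (ℚ.*-inverseˡ c)) (ℚ.*-identityʳ p))

private
  p<q⇒0<q-p : ∀ {p q} → p ℚ.< q → 0ℚ ℚ.< q - p
  p<q⇒0<q-p {p} {q} p<q = subst (ℚ._< q - p) (ℚ.+-inverseʳ p) (ℚ.+-monoˡ-< (- p) p<q)

  0<q-p⇒p<q : ∀ {p q} → 0ℚ ℚ.< q - p → p ℚ.< q
  0<q-p⇒p<q {p} {q} h = subst₂ ℚ._<_ (ℚ.+-identityˡ p)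
    (solve 2 (λ p q → (q :+ :- p) :+ p := q) refl p q) (ℚ.+-monoˡ-< p h)
    where open +-*-Solver

  0<p*q : ∀ {p q} → 0ℚ ℚ.< p → 0ℚ ℚ.< q → 0ℚ ℚ.< p * q
  0<p*q {p} {q} 0<p 0<q =
    ℚ.positive⁻¹ (p * q) {{ℚ.pos*pos⇒pos p {{positive 0<p}} q {{positive 0<q}}}}

  0≤p*q : ∀ {p q} → 0ℚ ℚ.≤ p → 0ℚ ℚ.≤ q → 0ℚ ℚ.≤ p * q
  0≤p*q {p} {q} 0≤p 0≤q = ℚ.nonNegative⁻¹ (p * q)
    {{ℚ.nonNeg*nonNeg⇒nonNeg p {{nonNegative 0≤p}} q {{nonNegative 0≤q}}}}

  *-square-mono-< : ∀ {p q} → 0ℚ ℚ.≤ p → p ℚ.< q → p * p ℚ.< q * q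
  *-square-mono-< {p} {q} 0≤p p<q = ℚ.≤-<-trans
    (ℚ.*-monoˡ-≤-nonNeg p {{nonNegative 0≤p}} (ℚ.<⇒≤ p<q))
    (ℚ.*-monoˡ-<-pos q {{positive (ℚ.≤-<-trans 0≤p p<q)}} p<q)

  -- With M = 1 + a, the point r = (M q + a) / (q + M) satisfies
  -- r - q = (a - q²) / (q + M) and a - r² = (M² - a) (a - q²) / (q + M)²,
  -- so it lies strictly between q and √a.
  module Towards√ (a q : ℚ) (0≤a : 0ℚ ℚ.≤ a) (0≤q : 0ℚ ℚ.≤ q) where
    open +-*-Solver

    M d e : ℚ
    M = 1ℚ + a
    d = q + M
    e = M * q + a

    0<M : 0ℚ ℚ.< M
    0<M = ℚ.+-mono-<-≤ (ℚ.positive⁻¹ 1ℚ) 0≤a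

    0<d : 0ℚ ℚ.< d
    0<d = ℚ.+-mono-≤-< 0≤q 0<M

    instance
      d>0 : Positive d
      d>0 = positive 0<d
      d≢0 : ℚ.NonZero d
      d≢0 = ℚ.pos⇒nonZero d
      dd≥0 : NonNegative (d * d)
      dd≥0 = nonNegative (0≤p*q (ℚ.<⇒≤ 0<d) (ℚ.<⇒≤ 0<d))
      d≥0 : NonNegative d
      d≥0 = nonNegative (ℚ.<⇒≤ 0<d)

    r : ℚ
    r = e * 1/ d

    r*d : r * d ≡ e
    r*d = trans (ℚ.*-assoc e (1/ d) d) (trans (cong (e *_) (ℚ.*-inverseˡ d)) (ℚ.*-identityʳ e))

    r*r*d*d : r * r * (d * d) ≡ e * e
    r*r*d*d = trans (solve 2 (λ r d → r :* r :* (d :* d) := r :* d :* (r :* d)) refl r d)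
                    (cong₂ _*_ r*d r*d)

    0<M*M-a : 0ℚ ℚ.< M * M - a
    0<M*M-a = subst (0ℚ ℚ.<_)
      (solve 1 (λ a → (con 1ℚ :+ a) :+ a :* a := (con 1ℚ :+ a) :* (con 1ℚ :+ a) :+ :- a) refl a)
      (ℚ.+-mono-<-≤ 0<M (0≤p*q 0≤a 0≤a))

    q<r : q * q ℚ.< a → q ℚ.< r
    q<r h = ℚ.*-cancelʳ-<-nonNeg d (subst (q * d ℚ.<_) (sym r*d) (0<q-p⇒p<q
      (subst (0ℚ ℚ.<_)
        (solve 2 (λ a q → a :+ :- (q :* q) :=
          ((con 1ℚ :+ a) :* q :+ a) :+ :- (q :* (q :+ (con 1ℚ :+ a)))) refl a q)
        (p<q⇒0<q-p h))))

    r<q : a ℚ.< q * q → r ℚ.< q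
    r<q h = ℚ.*-cancelʳ-<-nonNeg d (subst (ℚ._< q * d) (sym r*d) (0<q-p⇒p<q
      (subst (0ℚ ℚ.<_)
        (solve 2 (λ a q → q :* q :+ :- a :=
          q :* (q :+ (con 1ℚ :+ a)) :+ :- ((con 1ℚ :+ a) :* q :+ a)) refl a q)
        (p<q⇒0<q-p h))))

    r*r<a : q * q ℚ.< a → r * r ℚ.< a
    r*r<a h = ℚ.*-cancelʳ-<-nonNeg (d * d) (subst (ℚ._< a * (d * d)) (sym r*r*d*d) (0<q-p⇒p<q
      (subst (0ℚ ℚ.<_)
        (solve 2 (λ a q → let M = con 1ℚ :+ a; d = q :+ M; e = M :* q :+ a in
          (M :* M :+ :- a) :* (a :+ :- (q :* q)) := a :* (d :* d) :+ :- (e :* e)) refl a q)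
        (0<p*q 0<M*M-a (p<q⇒0<q-p h)))))

    a<r*r : a ℚ.< q * q → a ℚ.< r * r
    a<r*r h = ℚ.*-cancelʳ-<-nonNeg (d * d) (subst (a * (d * d) ℚ.<_) (sym r*r*d*d) (0<q-p⇒p<q
      (subst (0ℚ ℚ.<_)
        (solve 2 (λ a q → let M = con 1ℚ :+ a; d = q :+ M; e = M :* q :+ a in
          (M :* M :+ :- a) :* (q :* q :+ :- a) := e :* e :+ :- (a :* (d :* d))) refl a q)
        (0<p*q 0<M*M-a (p<q⇒0<q-p h)))))

    0<r : 0ℚ ℚ.< q → 0ℚ ℚ.< r
    0<r 0<q = ℚ.*-cancelʳ-<-nonNeg d (subst₂ ℚ._<_ (sym (ℚ.*-zeroˡ d)) (sym r*d)
      (ℚ.+-mono-<-≤ (0<p*q 0<M 0<q) 0≤a))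

√_ : ℕ → ℝ
√ n = record
  { lower         = L
  ; upper         = U
  ; lower-inhab   = - 1ℚ , inj₁ (ℚ.negative⁻¹ (- 1ℚ))
  ; upper-inhab   = 1ℚ + a , ℚ.+-mono-<-≤ (ℚ.positive⁻¹ 1ℚ) 0≤a ,
      0<q-p⇒p<q (subst (0ℚ ℚ.<_)
        (solve 1 (λ a → (con 1ℚ :+ a) :+ a :* a := (con 1ℚ :+ a) :* (con 1ℚ :+ a) :+ :- a) refl a)
        (ℚ.+-mono-<-≤ (ℚ.+-mono-<-≤ (ℚ.positive⁻¹ 1ℚ) 0≤a) (0≤p*q 0≤a 0≤a)))
  ; lower-rounded = λ {p} → mk⇔ L-open (λ (q , p<q , lq) → L-down {p} {q} p<q lq)
  ; upper-rounded = mk⇔ U-open λ (p , p<q , 0<p , a<pp) →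
      ℚ.<-trans 0<p p<q , ℚ.<-trans a<pp (*-square-mono-< (ℚ.<⇒≤ 0<p) p<q)
  ; disjoint      = λ where
      (inj₁ q<0  , 0<q , _)    → ℚ.<-asym q<0 0<q
      (inj₂ qq<a , _   , a<qq) → ℚ.<-asym qq<a a<qq
  ; located       = loc
  }
  where
  open +-*-Solver

  a : ℚ
  a = fromℤ (+ n)

  0≤a : 0ℚ ℚ.≤ a
  0≤a = ℚ.nonNegative⁻¹ a

  L U : ℚ → Set
  L q = q ℚ.< 0ℚ ⊎ q * q ℚ.< a
  U q = 0ℚ ℚ.< q × a ℚ.< q * q

  L-down : ∀ {p q} → p ℚ.< q → L q → L p
  L-down {p} p<q (inj₁ q<0)  = inj₁ (ℚ.<-trans p<q q<0)
  L-down {p} p<q (inj₂ qq<a) with p ℚ.<? 0ℚ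
  ... | yes p<0 = inj₁ p<0
  ... | no  p≮0 = inj₂ (ℚ.<-trans (*-square-mono-< (ℚ.≮⇒≥ p≮0) p<q) qq<a)

  L-open : ∀ {p} → L p → ∃[ q ] p ℚ.< q × L q
  L-open (inj₁ p<0) = case ℚ.<-dense p<0 of λ (m , p<m , m<0) → m , p<m , inj₁ m<0
  L-open {p} (inj₂ pp<a) with p ℚ.<? 0ℚ
  ... | yes p<0 = case ℚ.<-dense p<0 of λ (m , p<m , m<0) → m , p<m , inj₁ m<0
  ... | no  p≮0 = r , q<r pp<a , inj₂ (r*r<a pp<a)
    where open Towards√ a p 0≤a (ℚ.≮⇒≥ p≮0)

  U-open : ∀ {q} → U q → ∃[ p ] p ℚ.< q × U p
  U-open {q} (0<q , a<qq) = r , r<q a<qq , 0<r 0<q , a<r*r a<qq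
    where open Towards√ a q 0≤a (ℚ.<⇒≤ 0<q)

  loc : ∀ {p q} → p ℚ.< q → L p ⊎ U q
  loc {p} {q} p<q with p ℚ.<? 0ℚ | p * p ℚ.<? a
  ... | yes p<0 | _        = inj₁ (inj₁ p<0)
  ... | no  _   | yes pp<a = inj₁ (inj₂ pp<a)
  ... | no  p≮0 | no  pp≮a = inj₂
    ( ℚ.≤-<-trans (ℚ.≮⇒≥ p≮0) p<q
    , ℚ.≤-<-trans (ℚ.≮⇒≥ pp≮a) (*-square-mono-< (ℚ.≮⇒≥ p≮0) p<q))

infix 4 _⟶_ _≪_ _∈O_ _∈Ω_ _∈Θ_

_⟶_ : (ℕ → ℚ) → ℚ → Set
a ⟶ l = ∀ ε .{{_ : Positive ε}} → ∃[ k ] ∀ n → n ℕ.> k → ∣ a n - l ∣ ℚ.< ε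

-- Only used for nonnegative functions.  The bound f n < ε · g n then forces
-- 0 < g n, and it says that the quotient f n / g n is defined and below ε;
-- likewise in _∈O_.  Since ℚ is cofinal in ℝ and has arbitrarily small positive
-- elements, rational ε and c lose no generality.
_≪_ : (f g : ℕ → ℝ) → Set
f ≪ g = ∀ ε .{{_ : Positive ε}} → ∃[ k ] ∀ n → n ℕ.> k → f n < ε · g n

_∈O_ : (f g : ℕ → ℝ) → Set
f ∈O g = ∃[ c ] ∃[ k ] Σ[ c>0 ∈ Positive c ] ∀ n → n ℕ.> k → f n < _·_ c {{c>0}} (g n)

_∈Ω_ : (f g : ℕ → ℝ) → Set
f ∈Ω g = g ∈O f

_∈Θ_ : (f g : ℕ → ℝ) → Set
f ∈Θ g = f ∈O g × f ∈Ω g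

record Graph : Set₁ where
  field
    order    : ℕ
    nonEmpty : ℕ.NonZero order
    Adj      : Rel (Fin order) 0ℓ
    adj?     : Decidable Adj
    adj-sym  : Symmetric Adj
    adj-irr  : Irreflexive _≡_ Adj

open Graph

K : (n : ℕ) {{_ : ℕ.NonZero n}} → Graph
K n {{n≢0}} = record
  { order    = n
  ; nonEmpty = n≢0
  ; Adj      = _≢_
  ; adj?     = λ i j → ¬? (i Fin.≟ j)
  ; adj-sym  = _∘ sym
  ; adj-irr  = λ i≡j i≢j → i≢j i≡j
  }

-- A vertex of G □ H is the code in Fin (order G * order H) of a pair of
-- vertices; remQuot is the decoding bijection.
infixr 6 _□_

_□_ : Graph → Graph → Graph
G □ H = record
  { order    = order G ℕ.* order H
  ; nonEmpty = ℕ.m*n≢0 (order G) (order H) {{nonEmpty G}} {{nonEmpty H}}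
  ; Adj      = λ v w → PairAdj (decode v) (decode w)
  ; adj?     = λ v w → pairAdj? (decode v) (decode w)
  ; adj-sym  = λ where
      (inj₁ (eq , vw)) → inj₁ (sym eq , adj-sym H vw)
      (inj₂ (eq , vw)) → inj₂ (sym eq , adj-sym G vw)
  ; adj-irr  = λ where
      refl (inj₁ (_ , vv)) → adj-irr H refl vv
      refl (inj₂ (_ , vv)) → adj-irr G refl vv
  }
  where
  decode : Fin (order G ℕ.* order H) → Fin (order G) × Fin (order H)
  decode = remQuot (order H)

  PairAdj : Rel (Fin (order G) × Fin (order H)) 0ℓ
  PairAdj (v₁ , v₂) (w₁ , w₂) = (v₁ ≡ w₁ × Adj H v₂ w₂) ⊎ (v₂ ≡ w₂ × Adj G v₁ w₁)

  pairAdj? : Decidable PairAdj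
  pairAdj? (v₁ , v₂) (w₁ , w₂) =
    (v₁ Fin.≟ w₁ ×-dec adj? H v₂ w₂) ⊎-dec (v₂ Fin.≟ w₂ ×-dec adj? G v₁ w₁)

move : ∀ {N} → Fin N → Fin N → Vec ℕ N → Vec ℕ N
move u v C = updateAt (updateAt C u (ℕ._∸ 2)) v suc

module Pebbling (G : Graph) where

  Configuration : Set
  Configuration = Vec ℕ (order G)

  data Step (C : Configuration) : Configuration → Set where
    step : ∀ u v → Adj G u v → 2 ℕ.≤ lookup C u → Step C (move u v C)

  SolvableAt : Fin (order G) → Configuration → Set
  SolvableAt r C = ∃[ D ] Star Step C D × 1 ℕ.≤ lookup D r

  Solvable : Configuration → Set
  Solvable C = ∀ r → SolvableAt r C

private
  sum-suc : ∀ {N} (v : Fin N) C → sum (updateAt C v suc) ≡ suc (sum C)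
  sum-suc zero    (x ∷ C) = refl
  sum-suc (suc v) (x ∷ C) = trans (cong (x ℕ.+_) (sum-suc v C)) (ℕ.+-suc x (sum C))

  sum-∸2 : ∀ {N} (u : Fin N) C → 2 ℕ.≤ lookup C u → 2 ℕ.+ sum (updateAt C u (ℕ._∸ 2)) ≡ sum C
  sum-∸2 zero    (suc (suc x) ∷ C) _ = refl
  sum-∸2 zero    (suc zero ∷ C)    (s≤s ())
  sum-∸2 (suc u) (x ∷ C)           h = trans
    (trans (sym (ℕ.+-assoc 2 x s)) (trans (cong (ℕ._+ s) (ℕ.+-comm 2 x)) (ℕ.+-assoc x 2 s)))
    (cong (x ℕ.+_) (sum-∸2 u C h))
    where s = sum (updateAt C u (ℕ._∸ 2))

  sum-move : ∀ {N} (u v : Fin N) C → 2 ℕ.≤ lookup C u → sum (move u v C) ℕ.< sum C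
  sum-move u v C h = ℕ.≤-reflexive
    (trans (cong suc (sum-suc v (updateAt C u (ℕ._∸ 2)))) (sum-∸2 u C h))

module _ (G : Graph) where
  open Pebbling G

  private
    solvableAt-acc? : ∀ r C → Acc ℕ._<_ (sum C) → Dec (SolvableAt r C)
    solvableAt-acc? r C (acc rs) = Dec.map′ to from
      ((1 ℕ.≤? lookup C r) ⊎-dec any? λ u → any? λ v → try u v)
      where
      Via : Fin (order G) → Fin (order G) → Set
      Via u v = Adj G u v × 2 ℕ.≤ lookup C u × SolvableAt r (move u v C)

      try : ∀ u v → Dec (Via u v)
      try u v with adj? G u v | 2 ℕ.≤? lookup C u
      ... | no ¬a | _     = no (¬a ∘ proj₁)
      ... | yes _ | no ¬h = no (¬h ∘ proj₁ ∘ proj₂)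
      ... | yes a | yes h = Dec.map′ (λ s → a , h , s) (proj₂ ∘ proj₂)
        (solvableAt-acc? r (move u v C) (rs (sum-move u v C h)))

      to : (1 ℕ.≤ lookup C r ⊎ ∃ λ u → ∃ λ v → Via u v) → SolvableAt r C
      to (inj₁ h)                                   = C , ε , h
      to (inj₂ (u , v , uv , h , D , steps , done)) = D , step u v uv h ◅ steps , done

      from : SolvableAt r C → 1 ℕ.≤ lookup C r ⊎ ∃ λ u → ∃ λ v → Via u v
      from (_ , ε , h)                          = inj₁ h
      from (D , step u v uv h ◅ steps , done) = inj₂ (u , v , uv , h , D , steps , done)

  solvable? : ∀ C → Dec (Solvable C)
  solvable? C = all? λ r → solvableAt-acc? r C (<-wellFounded (sum C))

bump : ∀ {N} → Vec ℕ (suc N) → Vec ℕ (suc N)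
bump (x ∷ C) = suc x ∷ C

-- All configurations of t pebbles on N vertices, each listed once: either
-- the first vertex is empty, or removing a pebble from it leaves a
-- configuration of one pebble fewer.
configurations : (N t : ℕ) → List (Vec ℕ N)
configurations zero    zero    = [] ∷ []
configurations zero    (suc t) = []
configurations (suc N) zero    = map (0 ∷_) (configurations N zero)
configurations (suc N) (suc t) =
  map (0 ∷_) (configurations N (suc t)) ++ map bump (configurations (suc N) t)

∈-configurations : ∀ {N t} {C : Vec ℕ N} → C ∈ configurations N t ⇔ sum C ≡ t
∈-configurations = mk⇔ (sound _ _) (complete _ _)
  where
  sound : ∀ N t {C} → C ∈ configurations N t → sum C ≡ t
  sound zero    zero    (here refl) = refl
  sound (suc N) zero    C∈ with _ , D∈ , refl ← ∈-map⁻ (0 ∷_) C∈ = sound N zero D∈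
  sound (suc N) (suc t) C∈ with ∈-++⁻ (map (0 ∷_) (configurations N (suc t))) C∈
  ... | inj₁ C∈ˡ with _ , D∈ , refl ← ∈-map⁻ (0 ∷_) C∈ˡ = sound N (suc t) D∈
  ... | inj₂ C∈ʳ with (_ ∷ _) , D∈ , refl ← ∈-map⁻ bump C∈ʳ = cong suc (sound (suc N) t D∈)

  complete : ∀ N t {C} → sum C ≡ t → C ∈ configurations N t
  complete zero    t       {[]}        refl = here refl
  complete (suc N) zero    {zero ∷ C}  eq   = ∈-map⁺ (0 ∷_) (complete N zero eq)
  complete (suc N) (suc t) {zero ∷ C}  eq   = ∈-++⁺ˡ (∈-map⁺ (0 ∷_) (complete N (suc t) eq))
  complete (suc N) (suc t) {suc x ∷ C} eq   = ∈-++⁺ʳ (map (0 ∷_) (configurations N (suc t)))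
    (∈-map⁺ bump (complete (suc N) t {x ∷ C} (ℕ.suc-injective eq)))

configurations-unique : ∀ N t → Unique (configurations N t)
configurations-unique zero    zero    = [] ∷ []
configurations-unique zero    (suc t) = []
configurations-unique (suc N) zero    =
  Unique.map⁺ (λ {refl → refl}) (configurations-unique N zero)
configurations-unique (suc N) (suc t) = Unique.++⁺
  (Unique.map⁺ (λ {refl → refl}) (configurations-unique N (suc t)))
  (Unique.map⁺ (λ { {_ ∷ _} {_ ∷ _} refl → refl }) (configurations-unique (suc N) t))
  (λ (p , q) → disj (∈-map⁻ (0 ∷_) p) (∈-map⁻ bump q))
  where
  disj : ∀ {C} → (∃[ D ] D ∈ configurations N (suc t) × C ≡ 0 ∷ D) →
         ¬ (∃[ D ] D ∈ configurations (suc N) t × C ≡ bump D)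
  disj (_ , _ , refl) ((_ ∷ _) , _ , ())

configurations-nonEmpty : ∀ N t .{{_ : ℕ.NonZero N}} → ℕ.NonZero (length (configurations N t))
configurations-nonEmpty (suc N) t = member⇒nonEmpty
  (Function.Bundles.Equivalence.from (∈-configurations {C = t ∷ replicate N 0}) (sum-stack N t))
  where
  open import Data.Vec.Base using (replicate)

  sum-0s : ∀ N → sum (replicate N 0) ≡ 0
  sum-0s zero    = refl
  sum-0s (suc N) = sum-0s N

  sum-stack : ∀ N t → sum (t ∷ replicate N 0) ≡ t
  sum-stack N t = trans (cong (t ℕ.+_) (sum-0s N)) (ℕ.+-identityʳ t)

  member⇒nonEmpty : ∀ {A : Set} {x : A} {xs} → x ∈ xs → ℕ.NonZero (length xs)
  member⇒nonEmpty {xs = _ ∷ _} _ = _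

probSolvable : Graph → ℕ → ℚ
probSolvable G t = (+ length (filter (solvable? G) Ω) / length Ω)
  {{configurations-nonEmpty (order G) t {{nonEmpty G}}}}
  where
  Ω : List (Vec ℕ (order G))
  Ω = configurations (order G) t

-- The value at n is the (n + 1)-st graph of the sequence, and functions of
-- the position in a sequence are indexed in the same way.
GraphSequence : Set₁
GraphSequence = ℕ → Graph

P : GraphSequence → ℕ → ℕ → ℚ
P 𝒢 n t = probSolvable (𝒢 n) t

IsThreshold : GraphSequence → (ℕ → ℝ) → Set
IsThreshold 𝒢 f =
    (∀ (t : ℕ → ℕ) → f ≪ fromℕ ∘ t → (λ n → P 𝒢 n (t n)) ⟶ 1ℚ)
  × (∀ (t : ℕ → ℕ) → fromℕ ∘ t ≪ f → (λ n → P 𝒢 n (t n)) ⟶ 0ℚ)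

𝒦² : GraphSequence
𝒦² n = K (suc n) □ K (suc n)

{-# OPTIONS --safe #-}

-- A uniform configuration arises by Pólya's urn, adding one pebble at a time to
-- v with probability (C(v) + 1) / (N + t).
-- With t pebbles the chance that some vertex carries two is at most t² / N, and
-- without such a vertex no move is possible; this gives the lower bound on the
-- threshold.
-- For the upper bound, view the pebbled cells as edges of a bipartite graph on
-- rows and columns.  After 54 n pebbles, w.h.p. every n/3 rows and n/3 columns
-- span a pebbled cell, so some component is pebbled on at least n/3 cells.
-- A further O(n) pebbles put two pebbles on two different cells of it.  One of
-- these pairs can travel along the component until it meets the other, and two
-- adjacent doubled cells reach every vertex.
-- Both estimates hold for t a constant multiple of n, so a function outside
-- Θ(n) is refuted by such a t along a subsequence.
module Submission where

open import Defs
open import Axiom.ExcludedMiddle using (ExcludedMiddle)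
open import Data.Bool.Base using (Bool; true; false; T; if_then_else_)
open import Data.Empty using (⊥)
open import Data.Fin.Base using (Fin; zero; suc; combine; remQuot; _↑ˡ_; _↑ʳ_)
import Data.Fin.Properties as Fin
open import Data.Fin.Properties using (remQuot-combine; combine-remQuot)
import Data.Integer.Base as ℤ
import Data.Integer.Properties as ℤ
open import Data.List.Base using (List; []; _∷_; map; _++_; length; allFin; filter)
open import Data.List.Membership.Propositional using (_∈_)
open import Data.List.Membership.Propositional.Properties using (∈-allFin; ∈-map⁺; ∈-++⁺ˡ; ∈-++⁺ʳ)
open import Data.List.Properties using (map-∘; map-tabulate)
open import Data.List.Relation.Unary.Any using (here; there)
open import Data.Nat.Base hiding (_<_)
open import Data.Nat.DivMod using (_/_; _%_; m/n*n≤m; m≡m%n+[m/n]*n; m%n<n; m≥n⇒m/n>0)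
import Data.Nat.ListAction as List
open import Data.Nat.Properties
open import Algebra.Properties.CommutativeSemigroup *-commutativeSemigroup using (x∙yz≈y∙xz)
open import Data.Nat.Solver using (module +-*-Solver)
open import Data.Product using (_×_; _,_; proj₁; proj₂; ∃-syntax)
open import Data.Rational.Base as ℚ using (ℚ; mkℚ; 0ℚ; 1ℚ; ½; 1/_; Positive; NonNegative)
open import Data.Rational.Literals using (fromℤ)
import Data.Rational.Properties as ℚ
open import Data.Rational.Solver using () renaming (module +-*-Solver to ℚ-Solver)
open import Data.Rational.Unnormalised.Base using (mkℚᵘ; *≡*)
import Data.Rational.Unnormalised.Properties as ℚᵘ
open import Data.Sum.Base using (_⊎_; inj₁; inj₂)
open import Data.Unit.Base using (⊤; tt)
open import Data.Vec.Base using (Vec; []; _∷_; lookup; updateAt)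
import Data.Vec.Base as Vec
open import Data.Vec.Properties using (lookup∘updateAt; lookup∘updateAt′; lookup∘tabulate)
open import Function.Base using (_∘_; const; id)
open import Function.Bundles using (_⇔_; mk⇔; module Equivalence)
open import Level using (0ℓ)
open import Relation.Binary.Construct.Closure.ReflexiveTransitive as Star using (Star; ε; _◅_; _◅◅_)
open import Relation.Binary.PropositionalEquality
open import Relation.Nullary using (¬_; yes; no; does; contradiction)
open import Relation.Nullary.Decidable using (decidable-stable)
import Relation.Unary

-- The pebbles of a uniform configuration are not independent, so bounds for independent trials do
-- not apply. The urn supplies a substitute: whatever the present configuration, every vertex has
-- weight at least 1 in a total of `N + t`, so while `t ≤ N` the next pebble lands in a given set of
-- `g` vertices with probability at least `g / (2 N)`. Hence the estimates work with at most `n * n`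
-- pebbles, and monotonicity in `t` carries them further. A pair of row and column sets is hit at a
-- constant rate, and the exponentially small failure pays for a union over all pairs. Doubling a
-- cell of the giant component has a rate of order `1 / n` only, but no union is taken there, so a
-- much weaker bound on the waiting time is enough. Two pairs are needed because the component may
-- miss both the row and the column of the target: a single pair that moves onto an empty cell
-- becomes one pebble and is stuck. Probabilities appear as inequalities between counts, with all
-- denominators multiplied out.

private
  variable
    X Y : Set
    N : ℕ

-- Finite sums of natural numbers

opaque
  ∑ : List X → (X → ℕ) → ℕ
  ∑ xs f = List.sum (map f xs)

  ∑-[] : (f : X → ℕ) → ∑ [] f ≡ 0
  ∑-[] f = refl

  ∑-∷ : (x : X) (xs : List X) (f : X → ℕ) → ∑ (x ∷ xs) f ≡ f x + ∑ xs f
  ∑-∷ x xs f = refl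

  ∑-mono-∈ : (xs : List X) {f g : X → ℕ} → (∀ x → x ∈ xs → f x ≤ g x) → ∑ xs f ≤ ∑ xs g
  ∑-mono-∈ []       h = z≤n
  ∑-mono-∈ (x ∷ xs) h = +-mono-≤ (h x (here refl)) (∑-mono-∈ xs (λ y → h y ∘ there))

  ∑-mono : (xs : List X) {f g : X → ℕ} → (∀ x → f x ≤ g x) → ∑ xs f ≤ ∑ xs g
  ∑-mono xs h = ∑-mono-∈ xs (λ x _ → h x)

  ∑-cong-∈ : (xs : List X) {f g : X → ℕ} → (∀ x → x ∈ xs → f x ≡ g x) → ∑ xs f ≡ ∑ xs g
  ∑-cong-∈ []       h = refl
  ∑-cong-∈ (x ∷ xs) h = cong₂ _+_ (h x (here refl)) (∑-cong-∈ xs (λ y → h y ∘ there))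

  ∑-cong : (xs : List X) {f g : X → ℕ} → (∀ x → f x ≡ g x) → ∑ xs f ≡ ∑ xs g
  ∑-cong xs h = ∑-cong-∈ xs (λ x _ → h x)

  ∑-+ : (xs : List X) (f g : X → ℕ) → ∑ xs (λ x → f x + g x) ≡ ∑ xs f + ∑ xs g
  ∑-+ []       f g = refl
  ∑-+ (x ∷ xs) f g rewrite ∑-+ xs f g =
    solve 4 (λ a b c d → (a :+ b) :+ (c :+ d) := (a :+ c) :+ (b :+ d)) refl
      (f x) (g x) (∑ xs f) (∑ xs g)
    where open +-*-Solver

  ∑-*ˡ : (xs : List X) (c : ℕ) (f : X → ℕ) → ∑ xs (λ x → c * f x) ≡ c * ∑ xs f
  ∑-*ˡ []       c f = sym (*-zeroʳ c)
  ∑-*ˡ (x ∷ xs) c f rewrite ∑-*ˡ xs c f = sym (*-distribˡ-+ c (f x) (∑ xs f))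

  ∑-*ʳ : (xs : List X) (c : ℕ) (f : X → ℕ) → ∑ xs (λ x → f x * c) ≡ ∑ xs f * c
  ∑-*ʳ xs c f = trans (∑-cong xs (λ x → *-comm (f x) c)) (trans (∑-*ˡ xs c f) (*-comm c _))

  ∑-const : (xs : List X) (c : ℕ) → ∑ xs (const c) ≡ length xs * c
  ∑-const []       c = refl
  ∑-const (x ∷ xs) c = cong (c +_) (∑-const xs c)

  ∑-0 : (xs : List X) {f : X → ℕ} → (∀ x → x ∈ xs → f x ≡ 0) → ∑ xs f ≡ 0
  ∑-0 []       h = refl
  ∑-0 (x ∷ xs) h = cong₂ _+_ (h x (here refl)) (∑-0 xs (λ y → h y ∘ there))

  ∑-map : (xs : List X) (g : X → Y) (f : Y → ℕ) → ∑ (map g xs) f ≡ ∑ xs (f ∘ g)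
  ∑-map xs g f = cong List.sum (sym (map-∘ xs))

  ∑-++ : (xs ys : List X) (f : X → ℕ) → ∑ (xs ++ ys) f ≡ ∑ xs f + ∑ ys f
  ∑-++ []       ys f = refl
  ∑-++ (x ∷ xs) ys f = trans (cong (f x +_) (∑-++ xs ys f)) (sym (+-assoc (f x) _ _))

  ∑-swap : (xs : List X) (ys : List Y) (f : X → Y → ℕ) →
    ∑ xs (λ x → ∑ ys (f x)) ≡ ∑ ys (λ y → ∑ xs (λ x → f x y))
  ∑-swap []       ys f = sym (∑-0 ys (λ _ _ → refl))
  ∑-swap (x ∷ xs) ys f =
    trans (cong (∑ ys (f x) +_) (∑-swap xs ys f)) (sym (∑-+ ys (f x) _))

  term≤∑ : {xs : List X} {x : X} (f : X → ℕ) → x ∈ xs → f x ≤ ∑ xs f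
  term≤∑ f (here refl)          = m≤m+n _ _
  term≤∑ f (there {x = y} x∈xs) = ≤-trans (term≤∑ f x∈xs) (m≤n+m _ (f y))

  ∑ᶠ-suc : ∀ n (f : Fin (suc n) → ℕ) → ∑ (allFin (suc n)) f ≡ f zero + ∑ (allFin n) (f ∘ suc)
  ∑ᶠ-suc n f = cong (f zero +_)
    (trans (cong (λ l → ∑ l f) (sym (map-tabulate id suc))) (∑-map (allFin n) suc f))

∑ᶠ-const : ∀ n c → ∑ (allFin n) (const c) ≡ n * c
∑ᶠ-const zero    c = ∑-[] (const c)
∑ᶠ-const (suc n) c = trans (∑ᶠ-suc n (const c)) (cong (c +_) (∑ᶠ-const n c))

∑ᶠ-++ : ∀ m n (f : Fin (m + n) → ℕ) →
  ∑ (allFin (m + n)) f ≡ ∑ (allFin m) (λ i → f (i ↑ˡ n)) + ∑ (allFin n) (λ j → f (m ↑ʳ j))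
∑ᶠ-++ zero    n f = sym (cong (_+ ∑ (allFin n) f) (∑-[] (λ i → f (i ↑ˡ n))))
∑ᶠ-++ (suc m) n f = begin
  ∑ (allFin (suc m + n)) f               ≡⟨ ∑ᶠ-suc (m + n) f ⟩
  f zero + ∑ (allFin (m + n)) (f ∘ suc)  ≡⟨ cong (f zero +_) (∑ᶠ-++ m n (f ∘ suc)) ⟩
  f zero + (left + right)                ≡⟨ +-assoc (f zero) left right ⟨
  f zero + left + right                  ≡⟨ cong (_+ right) (∑ᶠ-suc m (λ i → f (i ↑ˡ n))) ⟨
  ∑ (allFin (suc m)) (λ i → f (i ↑ˡ n)) + right  ∎
  where
  open ≡-Reasoning
  left  = ∑ (allFin m) (λ i → f (suc i ↑ˡ n))
  right = ∑ (allFin n) (λ j → f (suc m ↑ʳ j))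

∑ᶠ-combine : ∀ m n (f : Fin (m * n) → ℕ) →
  ∑ (allFin (m * n)) f ≡ ∑ (allFin m) (λ i → ∑ (allFin n) (λ j → f (combine i j)))
∑ᶠ-combine zero    n f = trans (∑-[] f) (sym (∑-[] (λ i → ∑ (allFin n) (λ j → f (combine i j)))))
∑ᶠ-combine (suc m) n f = trans (∑ᶠ-++ n (m * n) f)
  (trans (cong (∑ (allFin n) (λ j → f (j ↑ˡ (m * n))) +_) (∑ᶠ-combine m n (λ v → f (n ↑ʳ v))))
    (sym (∑ᶠ-suc m (λ i → ∑ (allFin n) (λ j → f (combine i j))))))

∑-lookup : (C : Vec ℕ N) → ∑ (allFin N) (lookup C) ≡ Vec.sum C
∑-lookup []              = ∑-[] (lookup [])
∑-lookup {suc N} (x ∷ C) = trans (∑ᶠ-suc N (lookup (x ∷ C))) (cong (x +_) (∑-lookup C))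

-- Adding one pebble to all configurations

add : Fin N → Vec ℕ N → Vec ℕ N
add v C = updateAt C v suc

-- `add v` is a bijection from the configurations of `t` pebbles onto those of `suc t` pebbles that
-- occupy `v`, and the remaining ones contribute 0 by hypothesis. The proof follows the recursion of
-- `configurations`, which treats the first vertex specially: for `zero` it is immediate, for a
-- later vertex the part made by `bump` needs a second induction, on `t`.
∑-configurations-remove : ∀ N t (v : Fin N) (φ : Vec ℕ N → ℕ) →
  (∀ C → lookup C v ≡ 0 → φ C ≡ 0) →
  ∑ (configurations N (suc t)) φ ≡ ∑ (configurations N t) (φ ∘ add v)
∑-configurations-remove (suc N) t zero φ φ0 = begin
  ∑ (configurations (suc N) (suc t)) φ
    ≡⟨ ∑-++ (map (0 ∷_) (configurations N (suc t))) _ φ ⟩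
  ∑ (map (0 ∷_) (configurations N (suc t))) φ + ∑ (map bump (configurations (suc N) t)) φ
    ≡⟨ cong₂ _+_ (trans (∑-map _ _ φ) (∑-0 (configurations N (suc t)) (λ C _ → φ0 (0 ∷ C) refl))) (∑-map _ bump φ) ⟩
  ∑ (configurations (suc N) t) (φ ∘ bump)
    ≡⟨ ∑-cong (configurations (suc N) t) (λ { (x ∷ C) → refl }) ⟩
  ∑ (configurations (suc N) t) (φ ∘ add zero)                    ∎
  where open ≡-Reasoning
∑-configurations-remove (suc N) t (suc v) φ φ0 = begin
  ∑ (configurations (suc N) (suc t)) φ
    ≡⟨ ∑-++ (map (0 ∷_) (configurations N (suc t))) _ φ ⟩
  ∑ (map (0 ∷_) (configurations N (suc t))) φ + ∑ (map bump (configurations (suc N) t)) φ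
    ≡⟨ cong₂ _+_ (trans (∑-map _ _ φ) (∑-configurations-remove N t v (φ ∘ (0 ∷_)) (φ0 ∘ (0 ∷_)))) (∑-map _ bump φ) ⟩
  ∑ (configurations N t) (φ ∘ (0 ∷_) ∘ add v) + ∑ (configurations (suc N) t) (φ ∘ bump)
    ≡⟨ rest t ⟩
  ∑ (configurations (suc N) t) (φ ∘ add (suc v))                 ∎
  where
  open ≡-Reasoning

  bump0 : ∀ N {C} → C ∈ configurations N 0 → (v : Fin N) → lookup C v ≡ 0
  bump0 N {C} C∈ v = n≤0⇒n≡0 (subst (lookup C v ≤_) (Equivalence.to ∈-configurations C∈) (lookup≤sum C v))
    where
    lookup≤sum : ∀ {N} (C : Vec ℕ N) v → lookup C v ≤ Vec.sum C
    lookup≤sum (x ∷ C) zero    = m≤m+n x _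
    lookup≤sum (x ∷ C) (suc v) = ≤-trans (lookup≤sum C v) (m≤n+m _ x)

  lookup-bump : ∀ C → lookup (bump C) (suc v) ≡ lookup C (suc v)
  lookup-bump (x ∷ C) = refl

  rest : ∀ t →
    ∑ (configurations N t) (φ ∘ (0 ∷_) ∘ add v) + ∑ (configurations (suc N) t) (φ ∘ bump) ≡
    ∑ (configurations (suc N) t) (φ ∘ add (suc v))
  -- The only pebble is the one that `bump` put on the first vertex, so `suc v` is empty.
  rest zero = begin
    ∑ (configurations N 0) (φ ∘ (0 ∷_) ∘ add v) + ∑ (configurations (suc N) 0) (φ ∘ bump)
      ≡⟨ cong (∑ (configurations N 0) (φ ∘ (0 ∷_) ∘ add v) +_) (∑-0 (configurations (suc N) 0)
           (λ C C∈ → φ0 (bump C) (trans (lookup-bump C) (bump0 (suc N) C∈ (suc v))))) ⟩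
    ∑ (configurations N 0) (φ ∘ (0 ∷_) ∘ add v) + 0             ≡⟨ +-identityʳ _ ⟩
    ∑ (configurations N 0) (φ ∘ (0 ∷_) ∘ add v)
      ≡⟨ ∑-map (configurations N 0) (0 ∷_) (φ ∘ add (suc v)) ⟨
    ∑ (configurations (suc N) 0) (φ ∘ add (suc v))              ∎
  rest (suc t) = begin
    _ + ∑ (configurations (suc N) (suc t)) (φ ∘ bump)
      ≡⟨ cong₂ _+_ (sym (∑-map (configurations N (suc t)) (0 ∷_) (φ ∘ add (suc v))))
           (trans (∑-configurations-remove (suc N) t (suc v) (φ ∘ bump)
                    (λ C eq → φ0 (bump C) (trans (lookup-bump C) eq)))
             (trans (∑-cong (configurations (suc N) t) (λ { (x ∷ C) → refl }))
               (sym (∑-map (configurations (suc N) t) bump (φ ∘ add (suc v)))))) ⟩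
    _ ≡⟨ ∑-++ (map (0 ∷_) (configurations N (suc t))) _ (φ ∘ add (suc v)) ⟨
    ∑ (configurations (suc N) (suc t)) (φ ∘ add (suc v))        ∎

module _ (em : ExcludedMiddle 0ℓ) where

  -- Counting configurations

  -- Excluded middle turns every property into an event that can be counted, including those that
  -- quantify over walks or subsets.
  ind : Set → ℕ
  ind A = if does (em {A}) then 1 else 0

  ind-yes : {A : Set} → A → ind A ≡ 1
  ind-yes {A} a with em {A}
  ... | yes _ = refl
  ... | no ¬a = contradiction a ¬a

  ind-no : {A : Set} → ¬ A → ind A ≡ 0
  ind-no {A} ¬a with em {A}
  ... | yes a = contradiction a ¬a
  ... | no _  = refl

  ind-mono : {A B : Set} → (A → B) → ind A ≤ ind B
  ind-mono {A} A→B with em {A}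
  ... | yes a = ≤-reflexive (sym (ind-yes (A→B a)))
  ... | no _  = z≤n

  ind-¬ : (A : Set) → ind A + ind (¬ A) ≡ 1
  ind-¬ A with em {A}
  ... | yes a = cong suc (ind-no (λ ¬a → ¬a a))
  ... | no ¬a = ind-yes ¬a

  ind≤1 : (A : Set) → ind A ≤ 1
  ind≤1 A = ≤-trans (m≤m+n _ _) (≤-reflexive (ind-¬ A))

  total : ℕ → ℕ → ℕ
  total N t = length (configurations N t)

  number : ℕ → (Vec ℕ N → Set) → ℕ
  number {N} t F = ∑ (configurations N t) (λ C → ind (F C))

  number-mono : ∀ t {F G : Vec ℕ N → Set} → (∀ C → Vec.sum C ≡ t → F C → G C) → number t F ≤ number t G
  number-mono t F→G =
    ∑-mono-∈ (configurations _ t) (λ C C∈ → ind-mono (F→G C (Equivalence.to ∈-configurations C∈)))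

  number-¬ : ∀ t (F : Vec ℕ N → Set) → number t F + number t (¬_ ∘ F) ≡ total N t
  number-¬ {N} t F = begin
    number t F + number t (¬_ ∘ F)                              ≡⟨ ∑-+ Ω _ _ ⟨
    ∑ Ω (λ C → ind (F C) + ind (¬ F C))                         ≡⟨ ∑-cong Ω (λ C → ind-¬ (F C)) ⟩
    ∑ Ω (const 1)                                               ≡⟨ ∑-const Ω 1 ⟩
    length Ω * 1                                                ≡⟨ *-identityʳ _ ⟩
    total N t                                                   ∎
    where
    open ≡-Reasoning
    Ω = configurations N t

  -- The Pólya urn: adding a pebble to v with probability (C(v) + 1) / (N + t)
  -- turns a uniform configuration of t pebbles into one of t + 1 pebbles.
  urn : ∀ t (φ : Vec ℕ N → ℕ) →
    suc t * ∑ (configurations N (suc t)) φ ≡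
    ∑ (configurations N t) (λ C → ∑ (allFin N) (λ v → suc (lookup C v) * φ (add v C)))
  urn {N} t φ = begin
    suc t * ∑ Ω⁺ φ                                              ≡⟨ ∑-*ˡ Ω⁺ (suc t) φ ⟨
    -- Double counting of configurations with a marked pebble: `suc t` is the number of pebbles of
    -- `C`, and sorting them by vertex allows one pebble to be taken off.
    ∑ Ω⁺ (λ C → suc t * φ C)                                    ≡⟨ ∑-cong-∈ Ω⁺ (λ C C∈ → cong (_* φ C)
      (sym (trans (∑-lookup C) (Equivalence.to ∈-configurations C∈)))) ⟩
    ∑ Ω⁺ (λ C → ∑ (allFin N) (lookup C) * φ C)
      ≡⟨ ∑-cong Ω⁺ (λ C → ∑-*ʳ (allFin N) (φ C) (lookup C)) ⟨
    ∑ Ω⁺ (λ C → ∑ (allFin N) (λ v → lookup C v * φ C))          ≡⟨ ∑-swap Ω⁺ (allFin N) _ ⟩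
    ∑ (allFin N) (λ v → ∑ Ω⁺ (λ C → lookup C v * φ C))          ≡⟨ ∑-cong (allFin N) (λ v →
      ∑-configurations-remove N t v _ (λ C eq → cong (_* φ C) eq)) ⟩
    ∑ (allFin N) (λ v → ∑ Ω (λ C → lookup (add v C) v * φ (add v C)))
      ≡⟨ ∑-cong (allFin N) (λ v → ∑-cong Ω (λ C →
      cong (_* φ (add v C)) (lookup∘updateAt v C))) ⟩
    ∑ (allFin N) (λ v → ∑ Ω (λ C → suc (lookup C v) * φ (add v C))) ≡⟨ ∑-swap (allFin N) Ω _ ⟩
    ∑ Ω (λ C → ∑ (allFin N) (λ v → suc (lookup C v) * φ (add v C))) ∎
    where
    open ≡-Reasoning
    Ω  = configurations N t
    Ω⁺ = configurations N (suc t)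

  ∑-weights : (C : Vec ℕ N) → ∑ (allFin N) (λ v → suc (lookup C v)) ≡ N + Vec.sum C
  ∑-weights {N} C = trans (∑-+ (allFin N) (const 1) (lookup C))
    (cong₂ _+_ (trans (∑ᶠ-const N 1) (*-identityʳ N)) (∑-lookup C))

  -- The urn for the constant 1: its weights add up to `N + t` for every configuration. This ratio
  -- of consecutive totals replaces the binomial coefficients in all inductions on `t`.
  total-suc : ∀ N t → suc t * total N (suc t) ≡ (N + t) * total N t
  total-suc N t = begin
    suc t * total N (suc t)                                     ≡⟨ cong (suc t *_) (∑-1 Ω⁺) ⟨
    suc t * ∑ Ω⁺ (const 1)                                      ≡⟨ urn t (const 1) ⟩
    ∑ Ω (λ C → ∑ (allFin N) (λ v → suc (lookup C v) * 1))       ≡⟨ ∑-cong-∈ Ω (λ C C∈ →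
      trans (∑-cong (allFin N) (λ v → *-identityʳ _)) (trans (∑-weights C)
        (cong (N +_) (Equivalence.to ∈-configurations C∈)))) ⟩
    ∑ Ω (const (N + t))                                         ≡⟨ ∑-const Ω (N + t) ⟩
    total N t * (N + t)                                         ≡⟨ *-comm (total N t) (N + t) ⟩
    (N + t) * total N t                                         ∎
    where
    open ≡-Reasoning
    Ω  = configurations N t
    Ω⁺ = configurations N (suc t)
    ∑-1 : ∀ {X : Set} (xs : List X) → ∑ xs (const 1) ≡ length xs
    ∑-1 xs = trans (∑-const xs 1) (*-identityʳ _)

  -- Monotone properties under the urn

  UpClosed : (Vec ℕ N → Set) → Set
  UpClosed F = ∀ v {C} → F C → F (add v C)

  -- Divided by `N + t`, this is the conditional probability that the next pebble leads into `F`.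
  gain : (Vec ℕ N → Set) → Vec ℕ N → ℕ
  gain {N} F C = ∑ (allFin N) (λ v → suc (lookup C v) * ind (F (add v C)))

  gain-¬ : (F : Vec ℕ N → Set) (C : Vec ℕ N) → gain F C + gain (¬_ ∘ F) C ≡ N + Vec.sum C
  gain-¬ {N} F C = begin
    gain F C + gain (¬_ ∘ F) C                                  ≡⟨ ∑-+ (allFin N) _ _ ⟨
    _                                                           ≡⟨ ∑-cong (allFin N) (λ v →
      trans (sym (*-distribˡ-+ (suc (lookup C v)) (ind (F (add v C))) _))
        (trans (cong (suc (lookup C v) *_) (ind-¬ (F (add v C)))) (*-identityʳ _))) ⟩
    ∑ (allFin N) (λ v → suc (lookup C v))                       ≡⟨ ∑-weights C ⟩
    N + Vec.sum C                                               ∎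
    where open ≡-Reasoning

  gain-¬≡0 : {F : Vec ℕ N → Set} → UpClosed F → ∀ {C} → F C → gain (¬_ ∘ F) C ≡ 0
  gain-¬≡0 {N} up {C} FC = ∑-0 (allFin N) (λ v _ →
    trans (cong (suc (lookup C v) *_) (ind-no (λ ¬F → ¬F (up v FC)))) (*-zeroʳ (suc (lookup C v))))

  number-suc-≤ : ∀ t (F : Vec ℕ N → Set) (ψ : Vec ℕ N → ℕ) →
    (∀ C → Vec.sum C ≡ t → gain F C ≤ ψ C) →
    suc t * number (suc t) F ≤ ∑ (configurations N t) ψ
  number-suc-≤ {N} t F ψ h = ≤-trans (≤-reflexive (urn t (λ C → ind (F C))))
    (∑-mono-∈ (configurations N t) (λ C C∈ → h C (Equivalence.to ∈-configurations C∈)))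

  failures : ℕ → (Vec ℕ N → Set) → ℕ
  failures t F = number t (¬_ ∘ F)

  -- A new pebble cannot destroy `F`, so the urn never raises the probability of failure. Estimates
  -- are therefore needed at one number of pebbles only, small enough for the bounds on `gain`.
  failures-mono-≤ : ∀ {F : Vec ℕ N → Set} → UpClosed F → ∀ q {t u} → t ≤ u →
    q * failures t F ≤ total N t → q * failures u F ≤ total N u
  failures-mono-≤ {N} {F} up q {t} t≤u h with ≤⇒≤‴ t≤u
  ... | t≤‴u = go t≤‴u h
    where
    step : ∀ t → suc t * failures (suc t) F ≤ (N + t) * failures t F
    step t = ≤-trans (number-suc-≤ t (¬_ ∘ F) (λ C → (N + t) * ind (¬ F C)) bound)
      (≤-reflexive (∑-*ˡ (configurations N t) (N + t) _))
      where
      bound : ∀ C → Vec.sum C ≡ t → gain (¬_ ∘ F) C ≤ (N + t) * ind (¬ F C)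
      bound C refl with em {F C}
      ... | yes FC = ≤-trans (≤-reflexive (gain-¬≡0 up FC)) z≤n
      ... | no ¬FC = begin
        gain (¬_ ∘ F) C               ≤⟨ m≤n+m _ (gain F C) ⟩
        gain F C + gain (¬_ ∘ F) C    ≡⟨ gain-¬ F C ⟩
        N + t                         ≡⟨ *-identityʳ _ ⟨
        (N + t) * 1                   ≡⟨ cong ((N + t) *_) (ind-yes ¬FC) ⟨
        (N + t) * ind (¬ F C)         ∎
        where open ≤-Reasoning

    go : ∀ {t u} → t ≤‴ u → q * failures t F ≤ total N t → q * failures u F ≤ total N u
    go ≤‴-refl h = h
    go {t} (≤‴-step t≤u) h = go t≤u (*-cancelˡ-≤ (suc t) (begin
      suc t * (q * failures (suc t) F)     ≡⟨ x∙yz≈y∙xz (suc t) q _ ⟩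
      q * (suc t * failures (suc t) F)     ≤⟨ *-monoʳ-≤ q (step t) ⟩
      q * ((N + t) * failures t F)         ≡⟨ x∙yz≈y∙xz q (N + t) _ ⟩
      (N + t) * (q * failures t F)         ≤⟨ *-monoʳ-≤ (N + t) h ⟩
      (N + t) * total N t                  ≡⟨ total-suc N t ⟨
      suc t * total N (suc t)              ∎))
      where
      open ≤-Reasoning

  -- From E the next pebble achieves F with probability at least 1 / D, D = D′ + 1.
  failures-suc : ∀ {E F : Vec ℕ N → Set} → UpClosed F → (∀ {C} → F C → E C) →
    ∀ D′ t → (∀ C → Vec.sum C ≡ t → E C → N + t ≤ suc D′ * gain F C) →
    suc D′ * (suc t * failures (suc t) F) ≤ (N + t) * (failures t E + D′ * failures t F)
  failures-suc {N} {E} {F} up F→E D′ t likely = begin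
    suc D′ * (suc t * failures (suc t) F)                     ≡⟨ x∙yz≈y∙xz (suc D′) (suc t) _ ⟩
    suc t * (suc D′ * failures (suc t) F)                     ≡⟨ cong (suc t *_) (∑-*ˡ Ω⁺ (suc D′) _) ⟨
    suc t * ∑ Ω⁺ (λ C → suc D′ * ind (¬ F C))                 ≡⟨ urn t _ ⟩
    ∑ Ω (λ C → ∑ (allFin N) (λ v → suc (lookup C v) * (suc D′ * ind (¬ F (add v C)))))
      ≡⟨ ∑-cong Ω (λ C → trans (∑-cong (allFin N) (λ v → x∙yz≈y∙xz (suc (lookup C v)) (suc D′) _))
           (∑-*ˡ (allFin N) (suc D′) _)) ⟩
    ∑ Ω (λ C → suc D′ * gain (¬_ ∘ F) C)
      ≤⟨ ∑-mono-∈ Ω (λ C C∈ → bound C (Equivalence.to ∈-configurations C∈)) ⟩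
    ∑ Ω (λ C → (N + t) * (ind (¬ E C) + D′ * ind (¬ F C)))   ≡⟨ ∑-*ˡ Ω (N + t) _ ⟩
    (N + t) * ∑ Ω (λ C → ind (¬ E C) + D′ * ind (¬ F C))     ≡⟨ cong ((N + t) *_) (trans (∑-+ Ω _ _)
      (cong (failures t E +_) (∑-*ˡ Ω D′ _))) ⟩
    (N + t) * (failures t E + D′ * failures t F)              ∎
    where
    open ≤-Reasoning
    Ω  = configurations N t
    Ω⁺ = configurations N (suc t)

    bound : ∀ C → Vec.sum C ≡ t → suc D′ * gain (¬_ ∘ F) C ≤ (N + t) * (ind (¬ E C) + D′ * ind (¬ F C))
    bound C refl with em {F C} | em {E C}
    ... | yes FC | _ = ≤-trans (≤-reflexive (trans (cong (suc D′ *_) (gain-¬≡0 up FC)) (*-zeroʳ (suc D′)))) z≤n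
    ... | no ¬FC | no ¬EC = begin
      suc D′ * gain (¬_ ∘ F) C
        ≤⟨ *-monoʳ-≤ (suc D′) (≤-trans (m≤n+m _ (gain F C)) (≤-reflexive (gain-¬ F C))) ⟩
      suc D′ * (N + t)                ≡⟨ *-comm (suc D′) (N + t) ⟩
      (N + t) * (1 + D′)              ≡⟨ cong ((N + t) *_) (cong suc (*-identityʳ D′)) ⟨
      (N + t) * (1 + D′ * 1)          ≡⟨ cong₂ (λ x y → (N + t) * (x + D′ * y)) (ind-yes ¬EC) (ind-yes ¬FC) ⟨
      (N + t) * (ind (¬ E C) + D′ * ind (¬ F C)) ∎
    ... | no ¬FC | yes EC = begin
      -- The unfavourable draws have at most the share `D′ / suc D′` of the weight; adding `N + t`
      -- to both sides avoids a subtraction.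
      suc D′ * gain (¬_ ∘ F) C        ≤⟨ +-cancelˡ-≤ (N + t) _ _ (begin
        N + t + suc D′ * gain (¬_ ∘ F) C                     ≤⟨ +-monoˡ-≤ _ (likely C refl EC) ⟩
        suc D′ * gain F C + suc D′ * gain (¬_ ∘ F) C         ≡⟨ *-distribˡ-+ (suc D′) (gain F C) _ ⟨
        suc D′ * (gain F C + gain (¬_ ∘ F) C)                ≡⟨ cong (suc D′ *_) (gain-¬ F C) ⟩
        N + t + D′ * (N + t)                                 ∎) ⟩
      D′ * (N + t)                    ≡⟨ *-comm D′ (N + t) ⟩
      (N + t) * D′                    ≡⟨ cong ((N + t) *_) (*-identityʳ D′) ⟨
      (N + t) * (0 + D′ * 1)
        ≡⟨ cong₂ (λ x y → (N + t) * (x + D′ * y)) (ind-no (λ ¬E → ¬E EC)) (ind-yes ¬FC) ⟨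
      (N + t) * (ind (¬ E C) + D′ * ind (¬ F C)) ∎

  -- Whatever has happened before, each draw succeeds with probability at least `1 / D`, where
  -- `D = suc D′`, so the probability of failure picks up a factor `1 − 1 / D` every time. This is
  -- `failures-suc` with an `E` that always holds.
  failures-geometric : ∀ {F : Vec ℕ N → Set} → UpClosed F → ∀ D′ T →
    (∀ C → Vec.sum C ≤ T → N + Vec.sum C ≤ suc D′ * gain F C) →
    ∀ t → t ≤ T → suc D′ ^ t * failures t F ≤ D′ ^ t * total N t
  failures-geometric {N} {F} up D′ T likely zero _ = *-monoʳ-≤ 1
    (≤-trans (m≤n+m _ (number 0 F)) (≤-reflexive (number-¬ 0 F)))
  failures-geometric {N} {F} up D′ T likely (suc t) t<T = *-cancelˡ-≤ (suc t) (begin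
    suc t * (suc D′ ^ suc t * failures (suc t) F)
      ≡⟨ solve 4 (λ s d p y → s :* (d :* p :* y) := p :* (d :* (s :* y))) refl
           (suc t) (suc D′) (suc D′ ^ t) (failures (suc t) F) ⟩
    suc D′ ^ t * (suc D′ * (suc t * failures (suc t) F))
      ≤⟨ *-monoʳ-≤ (suc D′ ^ t) (failures-suc {E = λ _ → ⊤} up (λ _ → tt) D′ t
           (λ C eq _ → subst (λ u → N + u ≤ suc D′ * gain F C) eq
             (likely C (≤-trans (≤-reflexive eq) (≤-trans (n≤1+n t) t<T))))) ⟩
    suc D′ ^ t * ((N + t) * (failures t (λ _ → ⊤) + D′ * failures t F))
      ≡⟨ cong (λ x → suc D′ ^ t * ((N + t) * (x + D′ * failures t F)))
           (∑-0 (configurations N t) (λ C _ → ind-no (λ ¬⊤ → ¬⊤ tt))) ⟩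
    suc D′ ^ t * ((N + t) * (D′ * failures t F))
      ≡⟨ solve 4 (λ p a d x → p :* (a :* (d :* x)) := d :* a :* (p :* x)) refl
           (suc D′ ^ t) (N + t) D′ (failures t F) ⟩
    D′ * (N + t) * (suc D′ ^ t * failures t F)
      ≤⟨ *-monoʳ-≤ (D′ * (N + t)) (failures-geometric up D′ T likely t (≤-trans (n≤1+n t) t<T)) ⟩
    D′ * (N + t) * (D′ ^ t * total N t)
      ≡⟨ solve 4 (λ d a p m → d :* a :* (p :* m) := d :* p :* (a :* m)) refl D′ (N + t) (D′ ^ t) (total N t) ⟩
    D′ ^ suc t * ((N + t) * total N t)
      ≡⟨ cong (D′ ^ suc t *_) (total-suc N t) ⟨
    D′ ^ suc t * (suc t * total N (suc t))
      ≡⟨ x∙yz≈y∙xz (D′ ^ suc t) (suc t) _ ⟩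
    suc t * (D′ ^ suc t * total N (suc t)) ∎)
    where
    open ≤-Reasoning
    open +-*-Solver

  -- The probability of ¬F is at most that of ¬E plus (1 − 1/D)^s, which
  -- Bernoulli's inequality bounds by D / (D + s).
  failures-harmonic : ∀ {E F : Vec ℕ N → Set} → UpClosed F → (∀ {C} → F C → E C) → ∀ D′ T →
    (∀ C → Vec.sum C ≤ T → E C → N + Vec.sum C ≤ suc D′ * gain F C) →
    ∀ q t₀ → (∀ t → t₀ ≤ t → q * failures t E ≤ total N t) →
    ∀ s → t₀ + s ≤ T →
    q * (suc D′ + s) * failures (t₀ + s) F ≤ (suc D′ + s + q * suc D′) * total N (t₀ + s)
  failures-harmonic {N} {E} {F} up F→E D′ T likely q t₀ rareE zero _ = begin
    q * (suc D′ + 0) * failures (t₀ + 0) F                ≤⟨ *-monoʳ-≤ (q * (suc D′ + 0))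
      (≤-trans (m≤n+m _ (number (t₀ + 0) F)) (≤-reflexive (number-¬ (t₀ + 0) F))) ⟩
    q * (suc D′ + 0) * total N (t₀ + 0)                   ≤⟨ *-monoˡ-≤ (total N (t₀ + 0))
      (≤-trans (≤-reflexive (cong (q *_) (+-identityʳ (suc D′)))) (m≤n+m _ (suc D′ + 0))) ⟩
    (suc D′ + 0 + q * suc D′) * total N (t₀ + 0)          ∎
    where open ≤-Reasoning
  failures-harmonic {N} {E} {F} up F→E D′ T likely q t₀ rareE (suc s) t<T
    rewrite +-suc t₀ s = *-cancelˡ-≤ (suc D′ * suc t * (suc D′ + s)) (begin
    suc D′ * suc t * (suc D′ + s) * (q * (suc D′ + suc s) * x⁺)
      ≡⟨ solve 5 (λ d t s q y → let D = con 1 :+ d; u = con 1 :+ t in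
           D :* u :* (D :+ s) :* (q :* (D :+ (con 1 :+ s)) :* y) :=
           q :* (D :+ (con 1 :+ s)) :* (D :+ s) :* (D :* (u :* y))) refl D′ t s q x⁺ ⟩
    q * (suc D′ + suc s) * (suc D′ + s) * (suc D′ * (suc t * x⁺))
      ≤⟨ *-monoʳ-≤ (q * (suc D′ + suc s) * (suc D′ + s)) (failures-suc up F→E D′ t
           (λ C eq → subst (λ u → E C → N + u ≤ suc D′ * gain F C) eq
             (likely C (≤-trans (≤-reflexive eq) t≤T)))) ⟩
    q * (suc D′ + suc s) * (suc D′ + s) * ((N + t) * (e + D′ * x))
      ≡⟨ solve 6 (λ d s q a e x → let D = con 1 :+ d in
           q :* (D :+ (con 1 :+ s)) :* (D :+ s) :* (a :* (e :+ d :* x)) :=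
           (D :+ (con 1 :+ s)) :* a :* ((D :+ s) :* (q :* e) :+ d :* (q :* (D :+ s) :* x)))
           refl D′ s q (N + t) e x ⟩
    (suc D′ + suc s) * (N + t) * ((suc D′ + s) * (q * e) + D′ * (q * (suc D′ + s) * x))
      ≤⟨ *-monoʳ-≤ ((suc D′ + suc s) * (N + t)) (+-mono-≤
           (*-monoʳ-≤ (suc D′ + s) (rareE t (m≤m+n t₀ s)))
           (*-monoʳ-≤ D′ (failures-harmonic up F→E D′ T likely q t₀ rareE s t≤T))) ⟩
    (suc D′ + suc s) * (N + t) * ((suc D′ + s) * M + D′ * ((suc D′ + s + q * suc D′) * M))
      -- With `D = suc D′`, this is exactly what is lost in `(D − 1) / (D + s) ≤ D / (D + s + 1)`
      -- after clearing denominators, so the next line is a polynomial identity.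
      ≤⟨ m≤m+n _ (q * suc D′ * suc s * ((N + t) * M)) ⟩
    (suc D′ + suc s) * (N + t) * ((suc D′ + s) * M + D′ * ((suc D′ + s + q * suc D′) * M))
      + q * suc D′ * suc s * ((N + t) * M)
      ≡⟨ solve 5 (λ d s q a m → let D = con 1 :+ d; s⁺ = con 1 :+ s in
           (D :+ s⁺) :* a :* ((D :+ s) :* m :+ d :* ((D :+ s :+ q :* D) :* m)) :+ q :* D :* s⁺ :* (a :* m) :=
           D :* (D :+ s) :* (D :+ s⁺ :+ q :* D) :* (a :* m)) refl D′ s q (N + t) M ⟩
    suc D′ * (suc D′ + s) * (suc D′ + suc s + q * suc D′) * ((N + t) * M)
      ≡⟨ cong (suc D′ * (suc D′ + s) * (suc D′ + suc s + q * suc D′) *_) (total-suc N t) ⟨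
    suc D′ * (suc D′ + s) * (suc D′ + suc s + q * suc D′) * (suc t * M⁺)
      ≡⟨ solve 5 (λ d t s q m → let D = con 1 :+ d; s⁺ = con 1 :+ s; u = con 1 :+ t in
           D :* (D :+ s) :* (D :+ s⁺ :+ q :* D) :* (u :* m) :=
           D :* u :* (D :+ s) :* ((D :+ s⁺ :+ q :* D) :* m)) refl D′ t s q M⁺ ⟩
    suc D′ * suc t * (suc D′ + s) * ((suc D′ + suc s + q * suc D′) * M⁺) ∎)
    where
    open ≤-Reasoning
    open +-*-Solver
    t  = t₀ + s
    x  = failures t F
    x⁺  = failures (suc t) F
    e  = failures t E
    M  = total N t
    M⁺ = total N (suc t)
    t≤T : t ≤ T
    t≤T = ≤-trans (n≤1+n t) t<T

  -- With high probability as n and t / n grow, uniformly in both.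
  Typical : (∀ n → Vec ℕ (n * n) → Set) → Set
  Typical F = ∀ q → ∃[ c ] ∃[ k ] ∀ n → k ≤ n → ∀ t → c * n ≤ t →
    q * failures t (F n) ≤ total (n * n) t

  -- Once `E` holds, a draw succeeds with probability at least `1 / (12 n)`, so linearly many
  -- further pebbles suffice. The admissible error `1 / q` is split evenly between the failure of
  -- `E` and the waiting.
  Typical-next : ∀ {E F : ∀ n → Vec ℕ (n * n) → Set} → (∀ n → UpClosed (F n)) →
    (∀ n {C} → F n C → E n C) → ∀ k →
    (∀ n → k ≤ n → ∀ C → Vec.sum C ≤ n * n → E n C → n * n + Vec.sum C ≤ 12 * n * gain (F n) C) →
    Typical E → Typical F
  Typical-next {E} {F} up F→E k₀ likely typicalE q =
    -- Waiting for `s = 24 q n` draws, `2 q` times `12 n`, leaves an error of `1 / (1 + 2 q)`. A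
    -- board with `n ≥ c + 24 * q` keeps the number of pebbles within `n * n`.
    c + 24 * q , suc (k + k₀ + (c + 24 * q)) , bound
    where
    c = proj₁ (typicalE (2 * q))
    k = proj₁ (proj₂ (typicalE (2 * q)))

    bound : ∀ n → suc (k + k₀ + (c + 24 * q)) ≤ n → ∀ t → (c + 24 * q) * n ≤ t →
      q * failures t (F n) ≤ total (n * n) t
    bound n@(suc n′) (s≤s n-large) t t-large = failures-mono-≤ (up n) q
      (≤-trans (≤-reflexive u≡) t-large)
      (*-cancelˡ-≤ (2 * (12 * n + s)) (begin
        2 * (12 * n + s) * (q * failures u (F n))
          ≡⟨ solve 3 (λ w q x → con 2 :* w :* (q :* x) := con 2 :* q :* w :* x) refl (12 * n + s) q (failures u (F n)) ⟩
        2 * q * (12 * n + s) * failures u (F n)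
          -- `n′ + 11 * n` is `12 * n − 1`, as `D′` is one less than the denominator of the rate.
          ≤⟨ failures-harmonic (up n) (F→E n) (n′ + 11 * n) (n * n)
               (likely n (≤-trans (≤-trans (m≤n+m k₀ k) (m≤m+n (k + k₀) _)) n≥)) (2 * q) (c * n)
               (proj₂ (proj₂ (typicalE (2 * q))) n (≤-trans (≤-trans (m≤m+n k k₀) (m≤m+n (k + k₀) _)) n≥))
               s (≤-trans (≤-reflexive u≡) (*-monoˡ-≤ n (≤-trans (m≤n+m (c + 24 * q) (k + k₀)) n≥))) ⟩
        (12 * n + s + s) * total (n * n) u
          ≤⟨ *-monoˡ-≤ (total (n * n) u) (≤-trans (m≤n+m _ (12 * n))
               (≤-reflexive (solve 2 (λ w s → w :+ (w :+ s :+ s) := con 2 :* (w :+ s)) refl (12 * n) s))) ⟩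
        2 * (12 * n + s) * total (n * n) u ∎))
      where
      open ≤-Reasoning
      open +-*-Solver
      s = 2 * q * (12 * n)
      u = c * n + s
      u≡ : u ≡ (c + 24 * q) * n
      u≡ = solve 3 (λ c n q →
        c :* n :+ con 2 :* q :* (con 12 :* n) := (c :+ con 24 :* q) :* n) refl c n q
      n≥ : k + k₀ + (c + 24 * q) ≤ n
      n≥ = ≤-trans n-large (n≤1+n n′)

  -- Crowded vertices

  Crowded : Vec ℕ N → Set
  Crowded C = ∃[ v ] 2 ≤ lookup C v

  -- An uncrowded configuration becomes crowded only by a draw of an occupied vertex. Such a vertex
  -- holds one pebble and hence has weight 2.
  gain-Crowded : (C : Vec ℕ N) → gain Crowded C ≤ (N + Vec.sum C) * ind (Crowded C) + 2 * Vec.sum C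
  gain-Crowded {N} C with em {Crowded C}
  ... | yes cr = begin
    gain Crowded C                                   ≤⟨ m≤m+n _ _ ⟩
    gain Crowded C + gain (¬_ ∘ Crowded) C           ≡⟨ gain-¬ Crowded C ⟩
    N + Vec.sum C                                    ≡⟨ *-identityʳ _ ⟨
    (N + Vec.sum C) * 1                              ≤⟨ m≤m+n _ _ ⟩
    (N + Vec.sum C) * 1 + 2 * Vec.sum C              ∎
    where open ≤-Reasoning
  ... | no ¬cr = begin
    gain Crowded C                                   ≤⟨ ∑-mono (allFin N) (λ v → term v (lookup C v) refl) ⟩
    ∑ (allFin N) (λ v → 2 * lookup C v)              ≡⟨ ∑-*ˡ (allFin N) 2 (lookup C) ⟩
    2 * ∑ (allFin N) (lookup C)                      ≡⟨ cong (2 *_) (∑-lookup C) ⟩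
    2 * Vec.sum C                                    ≤⟨ m≤n+m _ ((N + Vec.sum C) * 0) ⟩
    (N + Vec.sum C) * 0 + 2 * Vec.sum C              ∎
    where
    open ≤-Reasoning
    term : ∀ v x → lookup C v ≡ x → suc x * ind (Crowded (add v C)) ≤ 2 * x
    term v zero eq = ≤-reflexive (cong (1 *_) (ind-no λ (w , two) → uncrowded w two))
      where
      uncrowded : ∀ w → ¬ 2 ≤ lookup (add v C) w
      uncrowded w two with w Fin.≟ v
      ... | yes refl rewrite lookup∘updateAt v {suc} C | eq = contradiction two λ { (s≤s ()) }
      ... | no  w≢v  rewrite lookup∘updateAt′ w v {suc} w≢v C = ¬cr (w , two)
    term v (suc zero) eq = *-monoʳ-≤ 2 (ind≤1 _)
    term v (suc (suc x)) eq = contradiction (v , subst (2 ≤_) (sym eq) (s≤s (s≤s z≤n))) ¬cr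

  -- The pebble added to `t` others raises the probability by at most `2 t / (N + t) ≤ 2 t / N`, and
  -- `t² + 2 t ≤ (t + 1)²` sums these increments.
  number-Crowded : ∀ N t → N * number t (Crowded {N}) ≤ t * t * total N t
  number-Crowded N zero = ≤-reflexive (trans (cong (N *_)
    (∑-0 (configurations N 0) (λ C C∈ → ind-no λ (v , two) →
      contradiction (≤-trans two (≤-trans (term≤∑ (lookup C) (∈-allFin v)) (≤-reflexive
        (trans (∑-lookup C) (Equivalence.to ∈-configurations C∈))))) λ ()))) (*-zeroʳ N))
  number-Crowded N (suc t) = *-cancelˡ-≤ (suc t) (begin
    suc t * (N * number (suc t) Crowded)          ≡⟨ x∙yz≈y∙xz (suc t) N _ ⟩
    N * (suc t * number (suc t) Crowded)
      ≤⟨ *-monoʳ-≤ N (number-suc-≤ t Crowded _ (λ C _ → gain-Crowded C)) ⟩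
    N * ∑ Ω (λ C → (N + Vec.sum C) * ind (Crowded C) + 2 * Vec.sum C)
      ≡⟨ cong (N *_) (∑-cong-∈ Ω (λ C C∈ → cong (λ u → (N + u) * ind (Crowded C) + 2 * u) (Equivalence.to ∈-configurations C∈))) ⟩
    N * ∑ Ω (λ C → (N + t) * ind (Crowded C) + 2 * t)
      ≡⟨ cong (N *_) (trans (∑-+ Ω _ _) (cong₂ _+_ (∑-*ˡ Ω (N + t) _) (∑-const Ω (2 * t)))) ⟩
    N * ((N + t) * number t Crowded + M * (2 * t))
      ≡⟨ solve 4 (λ n t x m → n :* ((n :+ t) :* x :+ m :* (con 2 :* t)) :=
           (n :+ t) :* (n :* x) :+ n :* (m :* (con 2 :* t))) refl N t (number t Crowded) M ⟩
    (N + t) * (N * number t Crowded) + N * (M * (2 * t))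
      ≤⟨ +-mono-≤ (*-monoʳ-≤ (N + t) (number-Crowded N t)) (*-monoˡ-≤ (M * (2 * t)) (m≤m+n N t)) ⟩
    (N + t) * (t * t * M) + (N + t) * (M * (2 * t))
      ≤⟨ m≤m+n _ ((N + t) * M) ⟩
    (N + t) * (t * t * M) + (N + t) * (M * (2 * t)) + (N + t) * M
      ≡⟨ solve 3 (λ a t m → a :* (t :* t :* m) :+ a :* (m :* (con 2 :* t)) :+ a :* m :=
           (con 1 :+ t) :* (con 1 :+ t) :* (a :* m)) refl (N + t) t M ⟩
    suc t * suc t * ((N + t) * M)                 ≡⟨ cong (suc t * suc t *_) (total-suc N t) ⟨
    suc t * suc t * (suc t * total N (suc t))     ≡⟨ x∙yz≈y∙xz (suc t * suc t) (suc t) _ ⟩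
    suc t * (suc t * suc t * total N (suc t))     ∎)
    where
    open ≤-Reasoning
    open +-*-Solver
    Ω = configurations N t
    M = total N t

  -- Moving doubled pebbles

  lookup-move-to : ∀ {u v : Fin N} C → v ≢ u → lookup (move u v C) v ≡ suc (lookup C v)
  lookup-move-to {u = u} {v} C v≢u =
    trans (lookup∘updateAt v (updateAt C u (_∸ 2))) (cong suc (lookup∘updateAt′ v u v≢u C))

  lookup-move-other : ∀ {u v w : Fin N} C → w ≢ u → lookup C w ≤ lookup (move u v C) w
  lookup-move-other {u = u} {v} {w} C w≢u with w Fin.≟ v
  ... | yes refl = ≤-trans (n≤1+n _) (≤-reflexive (sym (lookup-move-to C w≢u)))
  ... | no  w≢v  = ≤-reflexive (sym
    (trans (lookup∘updateAt′ w v w≢v (updateAt C u (_∸ 2))) (lookup∘updateAt′ w u w≢u C)))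

  lookup-add-≥ : ∀ (v w : Fin N) C → lookup C w ≤ lookup (add v C) w
  lookup-add-≥ v w C with w Fin.≟ v
  ... | yes refl = ≤-trans (n≤1+n _) (≤-reflexive (sym (lookup∘updateAt v C)))
  ... | no  w≢v  = ≤-reflexive (sym (lookup∘updateAt′ w v w≢v C))

  module Meeting (G : Graph) where
    open Graph G
    open Pebbling G

    private
      V = Fin order

    Adj⇒≢ : ∀ {u v} → Adj u v → v ≢ u
    Adj⇒≢ uv refl = adj-irr refl uv

    -- `O` is required of every vertex except the start, where the travelling pair already sits.
    data Walk (O : V → Set) : ℕ → V → V → Set where
      stop : ∀ {v} → Walk O 0 v v
      go   : ∀ {k u w v} → Adj u w → O w → Walk O k w v → Walk O (suc k) u v

    Walk-map : ∀ {O O′ : V → Set} {k u v} → (∀ {w} → O w → O′ w) → Walk O k u v → Walk O′ k u v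
    Walk-map f stop          = stop
    Walk-map f (go uw Ow ws) = go uw (f Ow) (Walk-map f ws)

    -- The remaining walk has to avoid `u` because moving away takes two pebbles from `u`, which may
    -- then be empty.
    Leave : (V → Set) → ℕ → V → V → Set
    Leave O k u v = ∃[ j ] ∃[ y ] suc j ≤ k × Adj u y × O y × y ≢ u × Walk (λ w → O w × w ≢ u) j y v

    -- Cutting a walk at its last visit to u.
    Walk-leave : ∀ {O k x v} u → u ≢ v → Walk O k x v → Walk (λ w → O w × w ≢ u) k x v ⊎ Leave O k u v
    Walk-leave u u≢v stop = inj₁ stop
    Walk-leave u u≢v (go {w = w} xw Ow ws) with Walk-leave u u≢v ws
    ... | inj₂ (j , y , j<k , rest) = inj₂ (j , y , ≤-trans j<k (n≤1+n _) , rest)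
    ... | inj₁ ws′ with w Fin.≟ u
    ...   | no w≢u = inj₁ (go xw (Ow , w≢u) ws′)
    ...   | yes refl with ws′
    ...     | stop                       = contradiction refl u≢v
    ...     | go uy (Oy , y≢u) ws″ = inj₂ (_ , _ , n≤1+n _ , uy , Oy , y≢u , ws″)

    Walk-leave-start : ∀ {O k u v} → u ≢ v → Walk O k u v → Leave O k u v
    Walk-leave-start {u = u} u≢v ws with Walk-leave u u≢v ws
    ... | inj₂ l                            = l
    ... | inj₁ stop                         = contradiction refl u≢v
    ... | inj₁ (go uy (Oy , y≢u) ws′) = _ , _ , ≤-refl , uy , Oy , y≢u , ws′

    Near : V → V → Set
    Near u v = u ≡ v ⊎ Adj u v

    after : ∀ {C D r} → Step C D → SolvableAt r D → SolvableAt r C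
    after s (E , steps , done) = E , s ◅ steps , done

    solvableAt-near : ∀ {C u r} → 2 ≤ lookup C u → Near u r → SolvableAt r C
    solvableAt-near {C} two (inj₁ refl) = C , ε , ≤-trans (n≤1+n 1) two
    solvableAt-near {C} {u} {r} two (inj₂ ur) = after (step u r ur two)
      (_ , ε , ≤-trans (s≤s z≤n) (≤-reflexive (sym (lookup-move-to C (Adj⇒≢ ur)))))

    -- Each pair sends one pebble to `z`, which then holds two and serves `r`. If `z` is `u` or `d`,
    -- the pair there does so alone.
    solvableAt-pair : ∀ {C u d z r} → u ≢ d → 2 ≤ lookup C u → 2 ≤ lookup C d →
      Near u z → Near d z → Near z r → SolvableAt r C
    solvableAt-pair u≢d twoᵘ twoᵈ (inj₁ refl) dz zr = solvableAt-near twoᵘ zr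
    solvableAt-pair u≢d twoᵘ twoᵈ (inj₂ uz) (inj₁ refl) zr = solvableAt-near twoᵈ zr
    solvableAt-pair {C} {u} {d} {z} u≢d twoᵘ twoᵈ (inj₂ uz) (inj₂ dz) zr =
      after (step u z uz twoᵘ) (after (step d z dz (≤-trans twoᵈ (lookup-move-other C (u≢d ∘ sym))))
        (solvableAt-near (≤-trans (s≤s (≤-trans (s≤s z≤n) (≤-reflexive (sym (lookup-move-to C (Adj⇒≢ uz))))))
          (≤-reflexive (sym (lookup-move-to (move u z C) (Adj⇒≢ dz))))) zr))

    -- In K n □ K n the hub is the cell where the line through u and d crosses a line through r.
    module _ (hub : ∀ {u d} → Adj u d → ∀ r → ∃[ z ] Near u z × Near d z × Near z r) where

      -- Pebbled vertices on a walk let the double pebble on u travel towards d.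
      solvable-meeting : ∀ k {j C u d} → j ≤ k → u ≢ d → 2 ≤ lookup C u → 2 ≤ lookup C d →
        Walk (λ w → 1 ≤ lookup C w) j u d → Solvable C
      solvable-meeting zero z≤n u≢d _ _ stop r = contradiction refl u≢d
      solvable-meeting (suc k) {C = C} {u} {d} j≤k u≢d twoᵘ twoᵈ ws r
        with i , y , i<j , uy , Oy , y≢u , ws′ ← Walk-leave-start u≢d ws | y Fin.≟ d
      ... | yes refl with z , uz , dz , zr ← hub uy r = solvableAt-pair u≢d twoᵘ twoᵈ uz dz zr
      -- The occupied `y` becomes doubled, while only `u` loses pebbles, and `u` is neither `d` nor
      -- on the remaining walk. That walk is not a subterm of `ws`, so the recursion is on a bound
      -- for the length.
      ... | no y≢d = after (step u y uy twoᵘ) (solvable-meeting k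
        (≤-pred (≤-trans i<j j≤k)) y≢d
        (≤-trans (s≤s Oy) (≤-reflexive (sym (lookup-move-to C y≢u))))
        (≤-trans twoᵈ (lookup-move-other C (u≢d ∘ sym)))
        (Walk-map (λ (Ow , w≢u) → ≤-trans Ow (lookup-move-other C w≢u)) ws′) r)

  -- Components of pebbled cells

  module Board (n : ℕ) where

    row col : Fin (n * n) → Fin n
    row v = proj₁ (remQuot {n} n v)
    col v = proj₂ (remQuot {n} n v)

    row-combine : ∀ i j → row (combine i j) ≡ i
    row-combine i j = cong proj₁ (remQuot-combine i j)

    col-combine : ∀ (i : Fin n) j → col (combine i j) ≡ j
    col-combine i j = cong proj₂ (remQuot-combine i j)

    row-col-injective : ∀ {u v} → row u ≡ row v → col u ≡ col v → u ≡ v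
    row-col-injective {u} {v} r c = trans (sym (combine-remQuot {n} n u))
      (trans (cong₂ (combine {n} {n}) r c) (combine-remQuot {n} n v))

    -- Two edges of the bipartite graph at once: rows suffice to describe connectivity, the column
    -- being the witness.
    Share : Vec ℕ (n * n) → Fin n → Fin n → Set
    Share C i i′ = ∃[ j ] 1 ≤ lookup C (combine i j) × 1 ≤ lookup C (combine i′ j)

    -- The component of row x in the bipartite graph of rows and columns whose
    -- edges are the pebbled cells.
    InComponent : Vec ℕ (n * n) → Fin n → Fin (n * n) → Set
    InComponent C x v = 1 ≤ lookup C v × Star (Share C) x (row v)

    InComponent-add : ∀ v C {x w} → InComponent C x w → InComponent (add v C) x w
    InComponent-add v C {w = w} (pebbled , conn) =
      ≤-trans pebbled (lookup-add-≥ v w C) ,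
      Star.map (λ {i} {i′} (j , p , q) →
        j , ≤-trans p (lookup-add-≥ v (combine i j) C) , ≤-trans q (lookup-add-≥ v (combine i′ j) C)) conn

    Doubled : Vec ℕ (n * n) → Fin n → Fin (n * n) → Set
    Doubled C x d = InComponent C x d × 2 ≤ lookup C d

    Doubled-add : ∀ v C {x d} → Doubled C x d → Doubled (add v C) x d
    Doubled-add v C {d = d} (comp , two) = InComponent-add v C comp , ≤-trans two (lookup-add-≥ v d C)

    Doubled-new : ∀ v C {x} → InComponent C x v → Doubled (add v C) x v
    Doubled-new v C comp = InComponent-add v C comp ,
      ≤-trans (s≤s (proj₁ comp)) (≤-reflexive (sym (lookup∘updateAt v C)))

    size : Vec ℕ (n * n) → Fin n → ℕ
    size C x = ∑ (allFin (n * n)) (λ v → ind (InComponent C x v))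

    Large : Vec ℕ (n * n) → Fin n → Set
    Large C x = n ≤ 3 * size C x

    Large-add : ∀ v C {x} → Large C x → Large (add v C) x
    Large-add v C large = ≤-trans large
      (*-monoʳ-≤ 3 (∑-mono (allFin (n * n)) (λ w → ind-mono (InComponent-add v C {w = w}))))

    -- A component is named by one of its rows, a name that stays valid while it grows or merges
    -- with others as pebbles are added.
    Giant Charged DoublyCharged : Vec ℕ (n * n) → Set
    Giant C = ∃[ x ] Large C x
    Charged C = ∃[ x ] Large C x × ∃[ d ] Doubled C x d
    DoublyCharged C = ∃[ x ] Large C x × ∃[ d ] ∃[ e ] e ≢ d × Doubled C x d × Doubled C x e

    Giant-up : UpClosed Giant
    Giant-up v {C} (x , large) = x , Large-add v C large

    Charged-up : UpClosed Charged
    Charged-up v {C} (x , large , d , dᵈ) = x , Large-add v C large , d , Doubled-add v C dᵈ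

    DoublyCharged-up : UpClosed DoublyCharged
    DoublyCharged-up v {C} (x , large , d , e , e≢d , dᵈ , dᵉ) =
      x , Large-add v C large , d , e , e≢d , Doubled-add v C dᵈ , Doubled-add v C dᵉ

  open Board

  -- Every vertex has weight at least 1 in the urn, so counting favourable vertices bounds the gain
  -- from below.
  gain-≥ : (F : Vec ℕ N → Set) (C : Vec ℕ N) (A : Fin N → Set) → (∀ v → A v → F (add v C)) →
    ∑ (allFin N) (λ v → ind (A v)) ≤ gain F C
  gain-≥ {N} F C A A→F = ∑-mono (allFin N) (λ v →
    ≤-trans (ind-mono (A→F v)) (m≤m+n _ (lookup C v * ind (F (add v C)))))

  -- The origin of the rate `1 / (12 n)`: at least `n / 6` favourable cells against a total weight
  -- of at most `2 n²`.
  weight-bound : ∀ n s g → s ≤ n * n → n ≤ 6 * g → n * n + s ≤ 12 * n * g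
  weight-bound n s g s≤nn n≤6g = begin
    n * n + s                  ≤⟨ +-monoʳ-≤ (n * n) s≤nn ⟩
    n * n + n * n              ≤⟨ +-mono-≤ (*-monoʳ-≤ n n≤6g) (*-monoʳ-≤ n n≤6g) ⟩
    n * (6 * g) + n * (6 * g)
      ≡⟨ solve 2 (λ n g → n :* (con 6 :* g) :+ n :* (con 6 :* g) := con 12 :* n :* g) refl n g ⟩
    12 * n * g                 ∎
    where
    open ≤-Reasoning
    open +-*-Solver

  Typical-Charged : Typical Giant → Typical Charged
  Typical-Charged = Typical-next Charged-up (λ n (x , large , _) → x , large) 0 likely
    where
    likely : ∀ n → 0 ≤ n → ∀ C → Vec.sum C ≤ n * n → Giant n C →
      n * n + Vec.sum C ≤ 12 * n * gain (Charged n) C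
    likely n _ C C≤ (x , large) = weight-bound n (Vec.sum C) g C≤ (begin
      n                  ≤⟨ large ⟩
      3 * size n C x     ≤⟨ *-monoʳ-≤ 3 (gain-≥ (Charged n) C (InComponent n C x) (λ v comp →
                              x , Large-add n v C large , v , Doubled-new n v C comp)) ⟩
      -- A third of `n` is available here; it is weakened to a sixth to share the rate with the
      -- second doubling.
      3 * g              ≤⟨ *-monoˡ-≤ g {3} {6} (s≤s (s≤s (s≤s z≤n))) ⟩
      6 * g              ∎)
      where
      open ≤-Reasoning
      g = gain (Charged n) C

  ∑-ind-≡ : ∀ {n} (d : Fin n) → ∑ (allFin n) (λ v → ind (v ≡ d)) ≡ 1
  ∑-ind-≡ {suc n} zero = trans (∑ᶠ-suc n _)
    (cong₂ _+_ (ind-yes refl) (∑-0 (allFin n) (λ v _ → ind-no λ ())))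
  ∑-ind-≡ {suc n} (suc d) = trans (∑ᶠ-suc n _)
    (cong₂ _+_ (ind-no λ ()) (trans (∑-cong (allFin n) (λ v → ≤-antisym
      (ind-mono Fin.suc-injective) (ind-mono (cong suc)))) (∑-ind-≡ d)))

  ∑-ind-except : (A : Fin N → Set) (d : Fin N) →
    ∑ (allFin N) (λ v → ind (A v)) ≤ suc (∑ (allFin N) (λ v → ind (A v × v ≢ d)))
  ∑-ind-except {N} A d = begin
    ∑ (allFin N) (λ v → ind (A v))                             ≤⟨ ∑-mono (allFin N) term ⟩
    ∑ (allFin N) (λ v → ind (v ≡ d) + ind (A v × v ≢ d))       ≡⟨ ∑-+ (allFin N) _ _ ⟩
    ∑ (allFin N) (λ v → ind (v ≡ d)) + _
      ≡⟨ cong (_+ ∑ (allFin N) (λ v → ind (A v × v ≢ d))) (∑-ind-≡ d) ⟩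
    suc (∑ (allFin N) (λ v → ind (A v × v ≢ d)))               ∎
    where
    open ≤-Reasoning
    term : ∀ v → ind (A v) ≤ ind (v ≡ d) + ind (A v × v ≢ d)
    term v with v Fin.≟ d
    ... | yes v≡d = ≤-trans (ind≤1 _) (≤-trans (≤-reflexive (sym (ind-yes v≡d))) (m≤m+n _ _))
    ... | no  v≢d = ≤-trans (ind-mono (_, v≢d)) (m≤n+m _ _)

  Typical-DoublyCharged : Typical Charged → Typical DoublyCharged
  Typical-DoublyCharged = Typical-next DoublyCharged-up
    (λ n (x , large , d , _ , _ , dᵈ , _) → x , large , d , dᵈ) 6 likely
    where
    likely : ∀ n → 6 ≤ n → ∀ C → Vec.sum C ≤ n * n → Charged n C →
      n * n + Vec.sum C ≤ 12 * n * gain (DoublyCharged n) C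
    -- The cell `d` must not be drawn again. From `n ≤ 3 (g + 1)` follows `2 n ≤ 6 g + 6`, and
    -- `6 ≤ n` absorbs the 6.
    likely n 6≤n C C≤ (x , large , d , dᵈ) = weight-bound n (Vec.sum C) g C≤ (+-cancelʳ-≤ n n (6 * g) (begin
      n + n                            ≤⟨ +-mono-≤ large large ⟩
      3 * size n C x + 3 * size n C x  ≤⟨ +-mono-≤ (*-monoʳ-≤ 3 enough) (*-monoʳ-≤ 3 enough) ⟩
      3 * suc g + 3 * suc g            ≡⟨ solve 1 (λ g → con 3 :* (con 1 :+ g) :+ con 3 :* (con 1 :+ g) :=
                                            con 6 :* g :+ con 6) refl g ⟩
      6 * g + 6                        ≤⟨ +-monoʳ-≤ (6 * g) 6≤n ⟩
      6 * g + n                        ∎))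
      where
      open ≤-Reasoning
      open +-*-Solver
      g = gain (DoublyCharged n) C

      enough : size n C x ≤ suc g
      enough = ≤-trans (∑-ind-except (InComponent n C x) d) (s≤s (gain-≥ (DoublyCharged n) C
        (λ v → InComponent n C x v × v ≢ d) (λ v (comp , v≢d) →
          x , Large-add n v C large , d , v , v≢d , Doubled-add n v C dᵈ , Doubled-new n v C comp)))

  -- Walks along a component

  module _ (m : ℕ) where
    private
      n = suc m
      G = 𝒦² m
      module B = Board n
    open Graph G using (Adj)
    open Pebbling G
    open Meeting G

    near-row : ∀ u v → B.row u ≡ B.row v → Near u v
    near-row u v r with B.col u Fin.≟ B.col v
    ... | yes c = inj₁ (B.row-col-injective r c)
    ... | no ¬c = inj₂ (inj₁ (r , ¬c))

    near-col : ∀ u v → B.col u ≡ B.col v → Near u v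
    near-col u v c with B.row u Fin.≟ B.row v
    ... | yes r = inj₁ (B.row-col-injective r c)
    ... | no ¬r = inj₂ (inj₂ (c , ¬r))

    hub : ∀ {u d} → Adj u d → ∀ r → ∃[ z ] Near u z × Near d z × Near z r
    hub {u} {d} (inj₁ (r≡ , _)) r = z ,
      near-row u z (sym z-row) , near-row d z (trans (sym r≡) (sym z-row)) ,
      near-col z r (B.col-combine (B.row u) (B.col r))
      where
      z = combine (B.row u) (B.col r)
      z-row = B.row-combine (B.row u) (B.col r)
    hub {u} {d} (inj₂ (c≡ , _)) r = z ,
      near-col u z (sym z-col) , near-col d z (trans (sym c≡) (sym z-col)) ,
      near-row z r (B.row-combine (B.row r) (B.col u))
      where
      z = combine (B.row r) (B.col u)
      z-col = B.col-combine (B.row r) (B.col u)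

    walk-near : ∀ {O u w v} → Near u w → O w → ∃[ k ] Walk O k w v → ∃[ k ] Walk O k u v
    walk-near (inj₁ refl) _  ws       = ws
    walk-near (inj₂ uw)   Ow (k , ws) = suc k , go uw Ow ws

    -- Consecutive edges of the bipartite graph share a row or a column, so their cells are adjacent
    -- or equal. Each `Share` contributes one move along a row and one along a column, and `Near`
    -- allows either to be void.
    connected-walk : ∀ C {i} u v → Star (B.Share C) i (B.row v) → B.row u ≡ i →
      1 ≤ lookup C v → ∃[ k ] Walk (λ w → 1 ≤ lookup C w) k u v
    connected-walk C u v ε r Ov = walk-near (near-row u v r) Ov (0 , stop)
    connected-walk C {i} u v (_◅_ {j = k} (j , p , q) conn) r Ov =
      walk-near (near-row u (combine i j) (trans r (sym (B.row-combine i j)))) p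
        (walk-near (near-col (combine i j) (combine k j) (trans (B.col-combine i j) (sym (B.col-combine k j)))) q
          (connected-walk C (combine k j) v conn (B.row-combine k j) Ov))

    DoublyCharged⇒Solvable : ∀ {C} → B.DoublyCharged C → Solvable C
    DoublyCharged⇒Solvable {C} (_ , _ , d , e , e≢d , ((_ , xd) , twoᵈ) , ((Oe , xe) , twoᵉ)) =
      let k , ws = connected-walk C d e (Star.reverse (λ (j , p , q) → j , q , p) xd Star.◅◅ xe) refl Oe
      in solvable-meeting hub k ≤-refl (e≢d ∘ sym) twoᵈ twoᵉ ws

  -- The giant component

  count : ∀ {n} → (Fin n → Set) → ℕ
  count {n} A = ∑ (allFin n) (λ i → ind (A i))

  count-mono : ∀ {n} {A B : Fin n → Set} → (∀ i → A i → B i) → count A ≤ count B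
  count-mono {n} A→B = ∑-mono (allFin n) (λ i → ind-mono (A→B i))

  count-¬ : ∀ {n} (A : Fin n → Set) → count A + count (¬_ ∘ A) ≡ n
  count-¬ {n} A = trans (sym (∑-+ (allFin n) _ _))
    (trans (∑-cong (allFin n) (λ i → ind-¬ (A i))) (trans (∑ᶠ-const n 1) (*-identityʳ n)))

  count-⊎ : ∀ {n} (A B : Fin n → Set) → count (λ i → A i ⊎ B i) ≤ count A + count B
  count-⊎ {n} A B = ≤-trans (∑-mono (allFin n) term) (≤-reflexive (∑-+ (allFin n) _ _))
    where
    term : ∀ i → ind (A i ⊎ B i) ≤ ind (A i) + ind (B i)
    term i with em {A i}
    ... | yes a = ≤-trans (ind≤1 (A i ⊎ B i)) (m≤m+n 1 (ind (B i)))
    ... | no ¬a = ind-mono λ { (inj₁ a) → contradiction a ¬a ; (inj₂ b) → b }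

  count-× : ∀ {n} (A B : Fin n → Set) →
    ∑ (allFin n) (λ i → ∑ (allFin n) (λ j → ind (A i × B j))) ≡ count A * count B
  count-× {n} A B = trans (∑-cong (allFin n) (λ i →
    trans (∑-cong (allFin n) (ind-× i)) (∑-*ˡ (allFin n) (ind (A i)) _))) (∑-*ʳ (allFin n) (count B) _)
    where
    ind-× : ∀ i j → ind (A i × B j) ≡ ind (A i) * ind (B j)
    ind-× i j with em {A i}
    ... | yes a = trans (≤-antisym (ind-mono proj₂) (ind-mono (a ,_))) (sym (+-identityʳ _))
    ... | no ¬a = ind-no (¬a ∘ proj₁)

  subsets : ∀ n → List (Vec Bool n)
  subsets zero    = [] ∷ []
  subsets (suc n) = map (true ∷_) (subsets n) ++ map (false ∷_) (subsets n)

  ∈-subsets : ∀ {n} (a : Vec Bool n) → a ∈ subsets n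
  ∈-subsets []                  = here refl
  ∈-subsets {suc n} (true ∷ a)  = ∈-++⁺ˡ (∈-map⁺ (true ∷_) (∈-subsets a))
  ∈-subsets {suc n} (false ∷ a) = ∈-++⁺ʳ (map (true ∷_) (subsets n)) (∈-map⁺ (false ∷_) (∈-subsets a))

  ∑-subsets : ∀ n c → ∑ (subsets n) (const c) ≡ 2 ^ n * c
  ∑-subsets zero    c = trans (∑-const (subsets 0) c) refl
  ∑-subsets (suc n) c = trans (∑-++ (map (true ∷_) (subsets n)) _ _)
    (trans (cong₂ _+_ (trans (∑-map (subsets n) _ _) (∑-subsets n c)) (trans (∑-map (subsets n) _ _) (∑-subsets n c)))
      (solve 2 (λ p c → p :* c :+ p :* c := con 2 :* p :* c) refl (2 ^ n) c))
    where open +-*-Solver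

  Hits : ∀ {n} → (A B : Fin n → Set) → Vec ℕ (n * n) → Set
  Hits A B C = ∃[ i ] ∃[ j ] A i × B j × 1 ≤ lookup C (combine i j)

  Third : ∀ {n} → (Fin n → Set) → Set
  Third {n} A = n ≤ 3 * count A

  In : ∀ {n} → Vec Bool n → Fin n → Set
  In a i = T (lookup a i)

  -- Boolean vectors are used so that the union bound is a sum over a finite list; `Spread-Hits`
  -- passes to arbitrary predicates.
  Spread : ∀ n → Vec ℕ (n * n) → Set
  Spread n C = ∀ (a b : Vec Bool n) → Third (In a) → Third (In b) → Hits (In a) (In b) C

  subset : ∀ {n} → (Fin n → Set) → Vec Bool n
  subset A = Vec.tabulate (λ i → does (em {A i}))

  In-subset : ∀ {n} (A : Fin n → Set) {i} → In (subset A) i → A i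
  In-subset A {i} t rewrite lookup∘tabulate (λ i → does (em {A i})) i with em {A i}
  ... | yes a = a

  subset-In : ∀ {n} (A : Fin n → Set) {i} → A i → In (subset A) i
  subset-In A {i} a rewrite lookup∘tabulate (λ i → does (em {A i})) i with em {A i}
  ... | yes _ = tt
  ... | no ¬a = contradiction a ¬a

  Spread-Hits : ∀ {n} C → Spread n C → (A B : Fin n → Set) → Third A → Third B → Hits A B C
  Spread-Hits {n} C spread A B largeA largeB
    with i , j , ai , bj , p ← spread (subset A) (subset B)
      (≤-trans largeA (*-monoʳ-≤ 3 (count-mono {n} (λ i → subset-In A))))
      (≤-trans largeB (*-monoʳ-≤ 3 (count-mono {n} (λ i → subset-In B))))
    = i , j , In-subset A ai , In-subset B bj , p

  module _ {n : ℕ} (C : Vec ℕ (n * n)) (spread : Spread n C) where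

    private
      O : Fin n → Fin n → Set
      O i j = 1 ≤ lookup C (combine i j)

    Small : (Fin n → Set) → Set
    Small A = suc (3 * count A) ≤ n

    third-complement : (A : Fin n → Set) → suc (3 * count A) ≤ n + n → Third (¬_ ∘ A)
    third-complement A A<2n = +-cancelˡ-≤ (n + n) _ _ (begin
      n + n + n                                     ≡⟨ solve 1 (λ n → n :+ n :+ n := con 3 :* n) refl n ⟩
      3 * n                                         ≡⟨ cong (3 *_) (count-¬ A) ⟨
      3 * (count A + count (¬_ ∘ A))                ≡⟨ *-distribˡ-+ 3 (count A) _ ⟩
      3 * count A + 3 * count (¬_ ∘ A)              ≤⟨ +-monoˡ-≤ _ (≤-trans (n≤1+n _) A<2n) ⟩
      n + n + 3 * count (¬_ ∘ A)                    ∎)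
      where
      open ≤-Reasoning
      open +-*-Solver

    Closed : (A B : Fin n → Set) → Set
    Closed A B = ∀ i j → O i j → (A i → B j) × (B j → A i)

    -- No pebbled cell joins `A` to the complement of `B`, or `B` to that of `A`. The complements
    -- contain a third by hypothesis, so a third in `A` or `B` would contradict `spread`.
    closed-small : ∀ {A B} → Closed A B → suc (3 * count A) ≤ n + n → suc (3 * count B) ≤ n + n →
      Small A × Small B
    closed-small {A} {B} closed A<2n B<2n =
      ≰⇒> (λ n≤A → let i , j , ai , ¬bj , p = Spread-Hits C spread A (¬_ ∘ B) n≤A (third-complement B B<2n)
                   in ¬bj (proj₁ (closed i j p) ai)) ,
      ≰⇒> (λ n≤B → let i , j , ¬ai , bj , p = Spread-Hits C spread (¬_ ∘ A) B (third-complement A A<2n) n≤B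
                   in ¬ai (proj₂ (closed i j p) bj))

    private
      rows cols : Fin n → Fin n → Set
      rows x i = Star (Share n C) x i
      cols x j = ∃[ i ] rows x i × O i j

      component-closed : ∀ x → Closed (rows x) (cols x)
      component-closed x i j p = (λ xi → i , xi , p) , (λ (i′ , xi′ , p′) → xi′ ◅◅ ((j , p′ , p) ◅ ε))

      rows* cols* : List (Fin n) → Fin n → Set
      rows* []       i = ⊥
      rows* (x ∷ xs) i = rows x i ⊎ rows* xs i
      cols* []       j = ⊥
      cols* (x ∷ xs) j = cols x j ⊎ cols* xs j

      unions-closed : ∀ xs → Closed (rows* xs) (cols* xs)
      unions-closed []       i j p = (λ ()) , (λ ())
      unions-closed (x ∷ xs) i j p =
        (λ { (inj₁ r) → inj₁ (proj₁ (component-closed x i j p) r) ; (inj₂ r) → inj₂ (proj₁ (unions-closed xs i j p) r) }) ,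
        (λ { (inj₁ k) → inj₁ (proj₂ (component-closed x i j p) k) ; (inj₂ k) → inj₂ (proj₂ (unions-closed xs i j p) k) })

      small-⊎ : ∀ {A B} → Small A → Small B → suc (3 * count (λ i → A i ⊎ B i)) ≤ n + n
      small-⊎ {A} {B} smallA smallB = begin
        suc (3 * count (λ i → A i ⊎ B i))   ≤⟨ s≤s (*-monoʳ-≤ 3 (count-⊎ A B)) ⟩
        suc (3 * (count A + count B))       ≡⟨ cong suc (*-distribˡ-+ 3 (count A) (count B)) ⟩
        suc (3 * count A + 3 * count B)     ≤⟨ +-mono-≤ smallA (≤-trans (n≤1+n _) smallB) ⟩
        n + n                               ∎
        where open ≤-Reasoning

      small-⊥ : 1 ≤ n → Small (λ _ → ⊥)
      small-⊥ 1≤n = ≤-trans (≤-reflexive (cong (λ c → suc (3 * c)) (∑-0 (allFin n) (λ _ _ → ind-no λ ())))) 1≤n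

      -- Closed sets are either below a third or above two thirds, so unions of
      -- small components stay small, although together they contain every row.
      all-small : 1 ≤ n → (∀ x → Small (rows x) × Small (cols x)) → ∀ xs → Small (rows* xs) × Small (cols* xs)
      all-small 1≤n small []       = small-⊥ 1≤n , small-⊥ 1≤n
      all-small 1≤n small (x ∷ xs) = closed-small (unions-closed (x ∷ xs))
        (small-⊎ (proj₁ (small x)) (proj₁ (all-small 1≤n small xs)))
        (small-⊎ (proj₂ (small x)) (proj₂ (all-small 1≤n small xs)))

      rows*-∈ : ∀ {xs i} → i ∈ xs → rows* xs i
      rows*-∈ (here refl)  = inj₁ ε
      rows*-∈ (there i∈xs) = inj₂ (rows*-∈ i∈xs)

      not-all-small : 1 ≤ n → ¬ (∀ x → Small (rows x) × Small (cols x))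
      not-all-small 1≤n small = <⇒≱ (proj₁ (all-small 1≤n small (allFin n))) (begin
        n                           ≤⟨ m≤m+n n (2 * n) ⟩
        3 * n                       ≡⟨ cong (3 *_) (trans (∑ᶠ-const n 1) (*-identityʳ n)) ⟨
        3 * ∑ (allFin n) (const 1)  ≤⟨ *-monoʳ-≤ 3 (∑-mono (allFin n) (λ i →
                                         ≤-reflexive (sym (ind-yes (rows*-∈ (∈-allFin i)))))) ⟩
        3 * count (rows* (allFin n))   ∎)
        where open ≤-Reasoning

      -- Each column of the component contains one of its pebbled cells, and cells in different
      -- columns are distinct.
      count≤size : ∀ x → count (cols x) ≤ size n C x
      count≤size x = begin
        ∑ (allFin n) (λ j → ind (cols x j))                                  ≤⟨ ∑-mono (allFin n) term ⟩
        ∑ (allFin n) (λ j → ∑ (allFin n) (λ i → ind (Cell (combine i j))))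
          ≡⟨ ∑-swap (allFin n) (allFin n) _ ⟨
        ∑ (allFin n) (λ i → ∑ (allFin n) (λ j → ind (Cell (combine i j))))
          ≡⟨ ∑ᶠ-combine n n (λ v → ind (Cell v)) ⟨
        size n C x                                                        ∎
        where
        open ≤-Reasoning
        Cell = InComponent n C x

        term : ∀ j → ind (cols x j) ≤ ∑ (allFin n) (λ i → ind (Cell (combine i j)))
        term j with em {cols x j}
        ... | no _ = z≤n
        ... | yes (i , r , p) = ≤-trans
          (≤-reflexive (sym (ind-yes (p , subst (rows x) (sym (row-combine n i j)) r))))
          (term≤∑ (λ i → ind (Cell (combine i j))) (∈-allFin i))

    Spread⇒Giant : 1 ≤ n → Giant n C
    Spread⇒Giant 1≤n with em {∃[ x ] Third (cols x)}
    ... | yes (x , large) = x , ≤-trans large (*-monoʳ-≤ 3 (count≤size x))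
    ... | no none = contradiction small (not-all-small 1≤n)
      where
      small : ∀ x → Small (rows x) × Small (cols x)
      -- A third of the rows would be joined by a pebbled cell to a column outside the component,
      -- since few columns lie inside.
      small x = ≰⇒> (λ n≤R →
          let i , j , r , ¬k , p = Spread-Hits C spread (rows x) (¬_ ∘ cols x) n≤R
                (third-complement (cols x) (≤-trans smallK (m≤m+n n n)))
          in ¬k (proj₁ (component-closed x i j p) r)) , smallK
        where
        smallK : Small (cols x)
        smallK = ≰⇒> (λ n≤K → none (x , n≤K))

  Hits-up : ∀ {n} (A B : Fin n → Set) → UpClosed (Hits A B)
  Hits-up A B v {C} (i , j , ai , bj , p) = i , j , ai , bj , ≤-trans p (lookup-add-≥ v (combine i j) C)

  -- A third of the rows and a third of the columns span a ninth of the cells, and at most `n * n`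
  -- pebbles at most double the weight of the urn: `18 = 2 * 9`.
  gain-Hits : ∀ n (A B : Fin n → Set) → Third A → Third B →
    ∀ C → Vec.sum C ≤ n * n → n * n + Vec.sum C ≤ 18 * gain (Hits A B) C
  gain-Hits n A B largeA largeB C C≤ = begin
    n * n + Vec.sum C                      ≤⟨ +-monoʳ-≤ (n * n) C≤ ⟩
    n * n + n * n                          ≤⟨ +-mono-≤ (*-mono-≤ largeA largeB) (*-mono-≤ largeA largeB) ⟩
    3 * a * (3 * b) + 3 * a * (3 * b)
      ≡⟨ solve 2 (λ a b → con 3 :* a :* (con 3 :* b) :+ con 3 :* a :* (con 3 :* b) :=
                                                con 18 :* (a :* b)) refl a b ⟩
    18 * (a * b)                           ≡⟨ cong (18 *_) (count-× A B) ⟨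
    18 * ∑ (allFin n) (λ i → ∑ (allFin n) (λ j → ind (A i × B j)))
      ≤⟨ *-monoʳ-≤ 18 (∑-mono (allFin n) (λ i → ∑-mono (allFin n) (λ j → ind-mono (λ (ai , bj) →
           subst A (sym (row-combine n i j)) ai , subst B (sym (col-combine n i j)) bj)))) ⟩
    18 * ∑ (allFin n) (λ i → ∑ (allFin n) (λ j → ind (Cell (combine i j))))
      ≡⟨ cong (18 *_) (∑ᶠ-combine n n (λ v → ind (Cell v))) ⟨
    18 * ∑ (allFin (n * n)) (λ v → ind (Cell v))
      ≤⟨ *-monoʳ-≤ 18 (gain-≥ (Hits A B) C Cell hit) ⟩
    18 * gain (Hits A B) C                 ∎
    where
    open ≤-Reasoning
    open +-*-Solver
    a = count A
    b = count B

    Cell : Fin (n * n) → Set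
    Cell v = A (row n v) × B (col n v)

    hit : ∀ v → Cell v → Hits A B (add v C)
    hit v (ai , bj) = row n v , col n v , ai , bj ,
      subst (λ w → 1 ≤ lookup (add v C) w) (sym (combine-remQuot {n} n v))
        (≤-trans (s≤s z≤n) (≤-reflexive (sym (lookup∘updateAt v C))))

  failures-Spread : ∀ n t → t ≤ n * n →
    18 ^ t * failures t (Spread n) ≤ 2 ^ n * (2 ^ n * (17 ^ t * total (n * n) t))
  failures-Spread n t t≤ = begin
    18 ^ t * failures t (Spread n)
      ≤⟨ *-monoʳ-≤ (18 ^ t) (∑-mono Ω pointwise) ⟩
    18 ^ t * ∑ Ω (λ C → ∑ 𝒮 (λ a → ∑ 𝒮 (λ b → ind (Miss a b C))))
      ≡⟨ cong (18 ^ t *_) (trans (∑-swap Ω 𝒮 _) (∑-cong 𝒮 (λ a → ∑-swap Ω 𝒮 _))) ⟩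
    18 ^ t * ∑ 𝒮 (λ a → ∑ 𝒮 (λ b → number t (Miss a b)))
      ≡⟨ trans (∑-cong 𝒮 (λ a → ∑-*ˡ 𝒮 (18 ^ t) _)) (∑-*ˡ 𝒮 (18 ^ t) _) ⟨
    ∑ 𝒮 (λ a → ∑ 𝒮 (λ b → 18 ^ t * number t (Miss a b)))
      ≤⟨ ∑-mono 𝒮 (λ a → ∑-mono 𝒮 (λ b → rare a b)) ⟩
    ∑ 𝒮 (λ a → ∑ 𝒮 (λ b → 17 ^ t * total (n * n) t))
      ≡⟨ trans (∑-cong 𝒮 (λ _ → ∑-subsets n _)) (∑-subsets n _) ⟩
    2 ^ n * (2 ^ n * (17 ^ t * total (n * n) t)) ∎
    where
    open ≤-Reasoning
    Ω = configurations (n * n) t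
    𝒮 = subsets n

    -- The size condition is part of the event, so the sum can run over all pairs; those with too
    -- small a set contribute 0.
    Miss : Vec Bool n → Vec Bool n → Vec ℕ (n * n) → Set
    Miss a b C = (Third (In a) × Third (In b)) × ¬ Hits (In a) (In b) C

    pointwise : ∀ C → ind (¬ Spread n C) ≤ ∑ 𝒮 (λ a → ∑ 𝒮 (λ b → ind (Miss a b C)))
    pointwise C with em {∃[ a ] ∃[ b ] Miss a b C}
    ... | no none = ≤-trans (≤-reflexive (ind-no (λ ¬spread → ¬spread (λ a b A B →
      decidable-stable em (λ ¬hits → none (a , b , (A , B) , ¬hits)))))) z≤n
    ... | yes (a , b , miss) = begin
      ind (¬ Spread n C)                              ≤⟨ ind≤1 _ ⟩
      1                                               ≡⟨ ind-yes miss ⟨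
      ind (Miss a b C)                                ≤⟨ term≤∑ (λ b → ind (Miss a b C)) (∈-subsets b) ⟩
      ∑ 𝒮 (λ b → ind (Miss a b C))
        ≤⟨ term≤∑ (λ a → ∑ 𝒮 (λ b → ind (Miss a b C))) (∈-subsets a) ⟩
      ∑ 𝒮 (λ a → ∑ 𝒮 (λ b → ind (Miss a b C)))        ∎

    rare : ∀ a b → 18 ^ t * number t (Miss a b) ≤ 17 ^ t * total (n * n) t
    rare a b with em {Third (In a) × Third (In b)}
    ... | yes (A , B) = ≤-trans (*-monoʳ-≤ (18 ^ t) (number-mono t (λ _ _ → proj₂)))
      (failures-geometric (Hits-up (In a) (In b)) 17 (n * n) (gain-Hits n (In a) (In b) A B) t t≤)
    ... | no ¬AB = ≤-trans (≤-reflexive (trans (cong (18 ^ t *_)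
      (∑-0 Ω (λ C _ → ind-no (¬AB ∘ proj₁)))) (*-zeroʳ (18 ^ t)))) z≤n

  n<2^n : ∀ n → suc n ≤ 2 ^ n
  n<2^n zero    = ≤-refl
  n<2^n (suc n) = begin
    1 + suc n      ≤⟨ +-mono-≤ (≤-trans (s≤s z≤n) (n<2^n n)) (n<2^n n) ⟩
    2 ^ n + 2 ^ n  ≡⟨ cong (2 ^ n +_) (+-identityʳ (2 ^ n)) ⟨
    2 ^ suc n      ∎
    where open ≤-Reasoning

  -- The constant 54 makes (17/18)^54 ≤ 1/8, which beats the 4^n pairs of subsets.
  Typical-Giant : Typical Giant
  -- `54 ≤ n` keeps `54 * n` within `n * n`, and `q ≤ n` gives `q ≤ 2 ^ n`.
  Typical-Giant q = 54 , suc (54 + q) , λ n n-large t 54n≤t → failures-mono-≤ (Giant-up n) q 54n≤t (bound n n-large)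
    where
    bound : ∀ n → suc (54 + q) ≤ n → q * failures (54 * n) (Giant n) ≤ total (n * n) (54 * n)
    bound n n-large = begin
      q * failures t (Giant n)
        ≤⟨ *-mono-≤ q≤2^n (number-mono t (λ C _ ¬giant spread → ¬giant (Spread⇒Giant C spread 1≤n))) ⟩
      2 ^ n * failures t (Spread n)      ≤⟨ *-cancelˡ-≤ (2 ^ n * (2 ^ n * 17 ^ t)) {{nz}} (begin
        2 ^ n * (2 ^ n * 17 ^ t) * (2 ^ n * failures t (Spread n))
          ≡⟨ solve 3 (λ p s x → p :* (p :* s) :* (p :* x) := p :* p :* p :* s :* x) refl (2 ^ n) (17 ^ t) _ ⟩
        2 ^ n * 2 ^ n * 2 ^ n * 17 ^ t * failures t (Spread n)
          ≤⟨ *-monoˡ-≤ _ powers ⟩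
        18 ^ t * failures t (Spread n)
          ≤⟨ failures-Spread n t (*-monoˡ-≤ n (≤-trans (≤-trans (m≤m+n 54 q) (n≤1+n _)) n-large)) ⟩
        2 ^ n * (2 ^ n * (17 ^ t * M))
          ≡⟨ solve 3 (λ p s m → p :* (p :* (s :* m)) := p :* (p :* s) :* m) refl (2 ^ n) (17 ^ t) M ⟩
        2 ^ n * (2 ^ n * 17 ^ t) * M     ∎) ⟩
      M                                  ∎
      where
      open ≤-Reasoning
      open +-*-Solver
      t = 54 * n
      M = total (n * n) t
      1≤n : 1 ≤ n
      1≤n = ≤-trans (s≤s z≤n) n-large
      q≤2^n : q ≤ 2 ^ n
      q≤2^n = ≤-trans (m≤n+m q 54) (≤-trans (≤-trans (n≤1+n _) n-large) (≤-trans (n≤1+n n) (n<2^n n)))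
      nz : NonZero (2 ^ n * (2 ^ n * 17 ^ t))
      nz = m*n≢0 (2 ^ n) _ {{m^n≢0 2 n}} {{m*n≢0 (2 ^ n) _ {{m^n≢0 2 n}} {{m^n≢0 17 t}}}}
      -- Two of the factors `2 ^ n` pay for the pairs of subsets, the third for `q`.
      powers : 2 ^ n * 2 ^ n * 2 ^ n * 17 ^ t ≤ 18 ^ t
      powers = begin
        2 ^ n * 2 ^ n * 2 ^ n * 17 ^ (54 * n)   ≡⟨ cong (2 ^ n * 2 ^ n * 2 ^ n *_) (^-*-assoc 17 54 n) ⟨
        2 ^ n * 2 ^ n * 2 ^ n * (17 ^ 54) ^ n   ≡⟨ product (17 ^ 54) n ⟩
        (8 * 17 ^ 54) ^ n                       ≤⟨ ^-monoˡ-≤ n (≤ᵇ⇒≤ (8 * 17 ^ 54) (18 ^ 54) tt) ⟩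
        (18 ^ 54) ^ n                           ≡⟨ ^-*-assoc 18 54 n ⟩
        18 ^ (54 * n)                           ∎
        where
        product : ∀ c n → 2 ^ n * 2 ^ n * 2 ^ n * c ^ n ≡ (8 * c) ^ n
        product c zero    = refl
        product c (suc n) = trans (solve 3 (λ p c s →
          con 2 :* p :* (con 2 :* p) :* (con 2 :* p) :* (c :* s) := con 8 :* c :* (p :* p :* p :* s)) refl (2 ^ n) c (c ^ n))
          (cong (8 * c *_) (product c n))

  open import Data.Integer.Base using (+_; -[1+_]; +≤+)

  -- Solvability with few and with many pebbles

  module _ (m : ℕ) where
    open Pebbling (𝒦² m)
    private
      N₀ = suc m * suc m

    -- If nothing can move, every vertex must be occupied from the start, for which there are too
    -- few pebbles.
    Solvable⇒Crowded : ∀ C → suc (Vec.sum C) ≤ N₀ → Solvable C → Crowded C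
    Solvable⇒Crowded C t<N solvable with em {Crowded C}
    ... | yes crowded = crowded
    ... | no ¬crowded = contradiction N≤t (<⇒≱ t<N)
      where
      pebbled : ∀ r → 1 ≤ lookup C r
      pebbled r with solvable r
      ... | _ , ε , done                  = done
      ... | _ , step u v uv two ◅ _ , _ = contradiction (u , two) ¬crowded

      N≤t : N₀ ≤ Vec.sum C
      N≤t = begin
        N₀                             ≡⟨ trans (∑ᶠ-const N₀ 1) (*-identityʳ N₀) ⟨
        ∑ (allFin N₀) (const 1)        ≤⟨ ∑-mono (allFin N₀) pebbled ⟩
        ∑ (allFin N₀) (lookup C)       ≡⟨ ∑-lookup C ⟩
        Vec.sum C                      ∎
        where open ≤-Reasoning

    -- `q * t ≤ n` and `t ≤ n` bound `q * t²` by `n²`. The summand 2 makes `t` strictly smaller than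
    -- `n²`, even on the board with one cell.
    Solvable-rare : ∀ q t → (2 + q) * t ≤ suc m → q * number t Solvable ≤ total N₀ t
    Solvable-rare q t small = *-cancelˡ-≤ N₀ (begin
      N₀ * (q * number t Solvable)           ≡⟨ x∙yz≈y∙xz N₀ q _ ⟩
      q * (N₀ * number t Solvable)           ≤⟨ *-monoʳ-≤ q (*-monoʳ-≤ N₀ (number-mono t (λ C eq →
                                                  Solvable⇒Crowded C (subst (λ u → suc u ≤ N₀) (sym eq) t<N)))) ⟩
      q * (N₀ * number t Crowded)            ≤⟨ *-monoʳ-≤ q (number-Crowded N₀ t) ⟩
      q * (t * t * total N₀ t)               ≡⟨ *-assoc q (t * t) _ ⟨
      q * (t * t) * total N₀ t               ≤⟨ *-monoˡ-≤ (total N₀ t) (begin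
        q * (t * t)                            ≡⟨ *-assoc q t t ⟨
        q * t * t                              ≤⟨ *-mono-≤ qt≤ t≤ ⟩
        N₀                                     ∎) ⟩
      N₀ * total N₀ t                        ∎)
      where
      open ≤-Reasoning
      2t≤ : 2 * t ≤ suc m
      2t≤ = ≤-trans (*-monoˡ-≤ t (m≤m+n 2 q)) small
      qt≤ : q * t ≤ suc m
      qt≤ = ≤-trans (*-monoˡ-≤ t (m≤n+m q 2)) small
      t≤ : t ≤ suc m
      t≤ = ≤-trans (m≤m+n t (t + 0)) 2t≤
      t≤m : t ≤ m
      t≤m = half t 2t≤
        where
        half : ∀ t → 2 * t ≤ suc m → t ≤ m
        half zero    _       = z≤n
        half (suc t) (s≤s h) = ≤-trans (s≤s (m≤m+n t 0)) (≤-trans (m≤n+m (suc (t + 0)) t) h)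
      t<N : suc t ≤ N₀
      t<N = ≤-trans (s≤s t≤m) (m≤m*n (suc m) (suc m))

  Solvable-typical : ∀ q → ∃[ c ] ∃[ k ] ∀ m → k ≤ suc m → ∀ t → c * suc m ≤ t →
    q * failures t (Pebbling.Solvable (𝒦² m)) ≤ total (suc m * suc m) t
  Solvable-typical q =
    let c , k , rare = Typical-DoublyCharged (Typical-Charged Typical-Giant) q
    in c , k , λ m k≤n t cn≤t → ≤-trans
      (*-monoʳ-≤ q (number-mono t (λ C _ ¬solvable dc → ¬solvable (DoublyCharged⇒Solvable m dc))))
      (rare (suc m) k≤n t cn≤t)

  -- Probabilities as rational numbers

  opaque
    ι : ℕ → ℚ
    ι n = fromℤ (+ n)

    ι-1 : ι 1 ≡ 1ℚ
    ι-1 = refl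

    instance
      ι-pos : ∀ {n} → Positive (ι (suc n))
      ι-pos = _

      ι-nonNeg : ∀ {n} → NonNegative (ι n)
      ι-nonNeg = _

    ι-* : ∀ a b → ι (a * b) ≡ ι a ℚ.* ι b
    ι-* a b = sym (trans (cong (ℚ._/ 1) (sym (ℤ.pos-* a b))) (ℚ.↥p/↧p≡p (ι (a * b))))

    ι-+ : ∀ a b → ι (a + b) ≡ ι a ℚ.+ ι b
    ι-+ a b = sym (trans (cong (ℚ._/ 1) (cong₂ ℤ._+_ (ℤ.*-identityʳ (+ a)) (ℤ.*-identityʳ (+ b))))
      (ℚ.↥p/↧p≡p (ι (a + b))))

    ι-mono-≤ : ∀ {a b} → a ≤ b → ι a ℚ.≤ ι b
    ι-mono-≤ a≤b = ℚ.*≤* (ℤ.*-monoʳ-≤-nonNeg (+ 1) (+≤+ a≤b))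

    ι-mono-< : ∀ {a b} → suc a ≤ b → ι a ℚ.< ι b
    ι-mono-< a<b = ℚ.*<* (ℤ.*-monoʳ-<-pos (+ 1) (ℤ.+<+ a<b))

    archimedean : ∀ x → ∃[ n ] x ℚ.< ι (suc n)
    archimedean (mkℚ (+ n) d _) = n , ℚ.*<* (ℤ.<-≤-trans
      (ℤ.≤-<-trans (ℤ.≤-reflexive (ℤ.*-identityʳ (+ n))) (ℤ.+<+ ≤-refl))
      (ℤ.≤-trans (+≤+ (m≤m*n (suc n) (suc d))) (ℤ.≤-reflexive (ℤ.pos-* (suc n) (suc d)))))
    archimedean (mkℚ -[1+ n ] d _) = 0 , ℚ.*<* ℤ.-<+

    /-* : ∀ g M → (+ g ℚ./ suc M) ℚ.* ι (suc M) ≡ ι g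
    /-* g M = ℚ.toℚᵘ-injective (ℚᵘ.≃-trans (ℚ.toℚᵘ-homo-* (+ g ℚ./ suc M) (ι (suc M)))
      (ℚᵘ.≃-trans (ℚᵘ.*-congʳ {ℚ.toℚᵘ (ι (suc M))} (ℚ.toℚᵘ-fromℚᵘ (mkℚᵘ (+ g) M)))
        (*≡* (trans (ℤ.*-identityʳ (+ g ℤ.* + suc M)) (cong (λ k → + g ℤ.* + k) (sym (*-identityʳ (suc M))))))))

  ι-cancel-< : ∀ {a b} → ι a ℚ.< ι b → suc a ≤ b
  ι-cancel-< ιa<ιb = ≰⇒> (λ b≤a → ℚ.<-irrefl refl (ℚ.<-≤-trans ιa<ιb (ι-mono-≤ b≤a)))

  length-filter : ∀ {F : Vec ℕ N → Set} (F? : Relation.Unary.Decidable F) (Ω : List (Vec ℕ N)) →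
    length (filter F? Ω) ≡ ∑ Ω (λ C → ind (F C))
  length-filter F? []      = sym (∑-[] _)
  length-filter F? (C ∷ Ω) with F? C
  ... | yes FC = trans (cong₂ _+_ (sym (ind-yes FC)) (length-filter F? Ω)) (sym (∑-∷ C Ω _))
  ... | no ¬FC = trans (cong₂ _+_ (sym (ind-no ¬FC)) (length-filter F? Ω)) (sym (∑-∷ C Ω _))

  module _ {y e m b k : ℚ} {{_ : Positive m}} {{_ : Positive k}} (y*m : y ℚ.* m ≡ b) (b≥0 : 0ℚ ℚ.≤ b)
           (e>0 : 0ℚ ℚ.< e) (1<ek : 1ℚ ℚ.< e ℚ.* k) (kb≤m : k ℚ.* b ℚ.≤ m) where

    -- `y` is `b / m`, given by its defining equation; `k * b ≤ m` makes it at most `1 / k`, which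
    -- is below `e`.
    quotient-< : y ℚ.< e
    quotient-< = ℚ.*-cancelʳ-<-nonNeg (m ℚ.* k) {{ℚ.pos⇒nonNeg (m ℚ.* k) {{ℚ.pos*pos⇒pos m k}}}} (begin-strict
      y ℚ.* (m ℚ.* k)     ≡⟨ ℚ.*-assoc y m k ⟨
      y ℚ.* m ℚ.* k       ≡⟨ cong (ℚ._* k) y*m ⟩
      b ℚ.* k             ≡⟨ ℚ.*-comm b k ⟩
      k ℚ.* b             ≤⟨ kb≤m ⟩
      m                   ≡⟨ ℚ.*-identityˡ m ⟨
      1ℚ ℚ.* m            <⟨ ℚ.*-monoˡ-<-pos m 1<ek ⟩
      e ℚ.* k ℚ.* m       ≡⟨ ℚ.*-assoc e k m ⟩
      e ℚ.* (k ℚ.* m)     ≡⟨ cong (e ℚ.*_) (ℚ.*-comm k m) ⟩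
      e ℚ.* (m ℚ.* k)     ∎)
      where open ℚ.≤-Reasoning

    neg-quotient-< : ℚ.- y ℚ.< e
    neg-quotient-< = ℚ.≤-<-trans (ℚ.neg-antimono-≤ (ℚ.*-cancelʳ-≤-pos {0ℚ} {y} m
      (ℚ.≤-trans (ℚ.≤-reflexive (ℚ.*-zeroˡ m)) (ℚ.≤-trans b≥0 (ℚ.≤-reflexive (sym y*m)))))) e>0

  ι≥0 : ∀ n → 0ℚ ℚ.≤ ι n
  ι≥0 n = ℚ.nonNegative⁻¹ (ι n)

  ι-scaled-≤ : ∀ q {b M} → q * b ≤ M → ι q ℚ.* ι b ℚ.≤ ι M
  ι-scaled-≤ q {b} qb≤M = ℚ.≤-trans (ℚ.≤-reflexive (sym (ι-* q b))) (ι-mono-≤ qb≤M)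

  ∣∣-< : ∀ {x e} → x ℚ.< e → ℚ.- x ℚ.< e → ℚ.∣ x ∣ ℚ.< e
  ∣∣-< {x} x<e -x<e with ℚ.∣p∣≡p∨∣p∣≡-p x
  ... | inj₁ eq = subst (ℚ._< _) (sym eq) x<e
  ... | inj₂ eq = subst (ℚ._< _) (sym eq) -x<e

  fraction-near-0 : ∀ g M .{{_ : NonZero M}} e → 0ℚ ℚ.< e → ∀ q → 1ℚ ℚ.< e ℚ.* ι (suc q) →
    suc q * g ≤ M → ℚ.∣ (+ g ℚ./ M) ℚ.- 0ℚ ∣ ℚ.< e
  fraction-near-0 g (suc M) e e>0 q 1<eq rare =
    subst (λ p → ℚ.∣ p ∣ ℚ.< e) (sym (ℚ.+-identityʳ (+ g ℚ./ suc M)))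
      (∣∣-< (quotient-< (/-* g M) (ι≥0 g) e>0 1<eq (ι-scaled-≤ (suc q) rare))
        (neg-quotient-< (/-* g M) (ι≥0 g) e>0 1<eq (ι-scaled-≤ (suc q) rare)))

  fraction-near-1 : ∀ g b M .{{_ : NonZero M}} e → g + b ≡ M → 0ℚ ℚ.< e → ∀ q → 1ℚ ℚ.< e ℚ.* ι (suc q) →
    suc q * b ≤ M → ℚ.∣ (+ g ℚ./ M) ℚ.- 1ℚ ∣ ℚ.< e
  fraction-near-1 g b (suc M) e g+b e>0 q 1<eq rare = ∣∣-<
    (subst (ℚ._< e) (solve 1 (λ p → :- (con 1ℚ :- p) := p :- con 1ℚ) refl p)
      (neg-quotient-< y*M (ι≥0 b) e>0 1<eq (ι-scaled-≤ (suc q) rare)))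
    (subst (ℚ._< e) (solve 1 (λ p → con 1ℚ :- p := :- (p :- con 1ℚ)) refl p)
      (quotient-< y*M (ι≥0 b) e>0 1<eq (ι-scaled-≤ (suc q) rare)))
    where
    open ℚ-Solver
    p = + g ℚ./ suc M
    y*M : (1ℚ ℚ.- p) ℚ.* ι (suc M) ≡ ι b
    y*M = begin
      (1ℚ ℚ.- p) ℚ.* ι (suc M)
        ≡⟨ solve 2 (λ p m → (con 1ℚ :- p) :* m := m :- p :* m) refl p (ι (suc M)) ⟩
      ι (suc M) ℚ.- p ℚ.* ι (suc M)         ≡⟨ cong (λ x → ι (suc M) ℚ.- x) (/-* g M) ⟩
      ι (suc M) ℚ.- ι g                     ≡⟨ cong (λ k → ι k ℚ.- ι g) g+b ⟨
      ι (g + b) ℚ.- ι g                     ≡⟨ cong (λ x → x ℚ.- ι g) (ι-+ g b) ⟩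
      ι g ℚ.+ ι b ℚ.- ι g                   ≡⟨ solve 2 (λ g b → g :+ b :- g := b) refl (ι g) (ι b) ⟩
      ι b                                   ∎
      where open ≡-Reasoning

  inverse-< : ∀ e .{{_ : Positive e}} → ∃[ q ] 1ℚ ℚ.< e ℚ.* ι (suc q)
  inverse-< e = let q , e⁻¹<q = archimedean ((1/ e) {{ℚ.pos⇒nonZero e}}) in q ,
    subst (ℚ._< e ℚ.* ι (suc q)) (ℚ.*-inverseʳ e {{ℚ.pos⇒nonZero e}}) (ℚ.*-monoʳ-<-pos e e⁻¹<q)

  module _ (G : Graph) (t : ℕ) where
    open Graph G
    open Pebbling G

    private
      Ω = configurations order t
      Ω≢∅ : NonZero (total order t)
      Ω≢∅ = configurations-nonEmpty order t {{nonEmpty}}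
      g = length (filter (solvable? G) Ω)
      g≡ : g ≡ number t Solvable
      g≡ = length-filter (solvable? G) Ω

    module _ e (e>0 : 0ℚ ℚ.< e) q (1<eq : 1ℚ ℚ.< e ℚ.* ι (suc q)) where

      probSolvable-near-0 : suc q * number t Solvable ≤ total order t → ℚ.∣ probSolvable G t ℚ.- 0ℚ ∣ ℚ.< e
      probSolvable-near-0 rare = fraction-near-0 g (total order t) {{Ω≢∅}} e e>0 q 1<eq
        (≤-trans (≤-reflexive (cong (suc q *_) g≡)) rare)

      probSolvable-near-1 : suc q * failures t Solvable ≤ total order t → ℚ.∣ probSolvable G t ℚ.- 1ℚ ∣ ℚ.< e
      probSolvable-near-1 = fraction-near-1 g (failures t Solvable) (total order t) {{Ω≢∅}} e
        (trans (cong (_+ failures t Solvable) g≡) (number-¬ t Solvable)) e>0 q 1<eq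

  -- With `P-near-1`, all that the threshold argument uses about pebbling: bounds uniform in `t`,
  -- each valid from a constant multiple of `n` on, downwards or upwards.
  P-near-0 : ∀ e .{{_ : Positive e}} → ∃[ d ] ∀ m t → suc d * t ≤ suc m → ℚ.∣ P 𝒦² m t ℚ.- 0ℚ ∣ ℚ.< e
  P-near-0 e = let q , 1<eq = inverse-< e in 2 + q , λ m t small →
    probSolvable-near-0 (𝒦² m) t e (ℚ.positive⁻¹ e) q 1<eq (Solvable-rare m (suc q) t small)

  P-near-1 : ∀ e .{{_ : Positive e}} → ∃[ c ] ∃[ k ] ∀ m → k ≤ suc m → ∀ t → c * suc m ≤ t →
    ℚ.∣ P 𝒦² m t ℚ.- 1ℚ ∣ ℚ.< e
  P-near-1 e =
    let q , 1<eq = inverse-< e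
        c , k , rare = Solvable-typical (suc q)
    in c , k , λ m k≤n t cn≤t → probSolvable-near-1 (𝒦² m) t e (ℚ.positive⁻¹ e) q 1<eq (rare m k≤n t cn≤t)

  open ℝ

  -- Comparing cuts with multiples of naturals

  lower-down : ∀ x {p q} → p ℚ.≤ q → lower x q → lower x p
  lower-down x p≤q lq with q′ , q<q′ , lq′ ← Equivalence.to (lower-rounded x) lq =
    Equivalence.from (lower-rounded x) (q′ , ℚ.≤-<-trans p≤q q<q′ , lq′)

  lower<upper : ∀ x {p q} → lower x p → upper x q → p ℚ.< q
  lower<upper x lp uq = ℚ.≰⇒> (λ q≤p → disjoint x (lower-down x q≤p lp , uq))

  ¬upper⇒lower : ∀ x {p q} → p ℚ.< q → ¬ upper x q → lower x p
  ¬upper⇒lower x p<q ¬uq with located x p<q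
  ... | inj₁ lp = lp
  ... | inj₂ uq = contradiction uq ¬uq

  ¬lower⇒upper : ∀ x {p q} → p ℚ.< q → ¬ lower x p → upper x q
  ¬lower⇒upper x p<q ¬lp with located x p<q
  ... | inj₁ lp = contradiction lp ¬lp
  ... | inj₂ uq = uq

  module Inverse (c : ℚ) .{{c>0 : Positive c}} where
    c⁻¹ : ℚ
    c⁻¹ = (1/ c) {{ℚ.pos⇒nonZero c}}

    instance
      c⁻¹>0 : Positive c⁻¹
      c⁻¹>0 = ℚ.1/pos⇒pos c

    c*[x*c⁻¹] : ∀ x → c ℚ.* (x ℚ.* c⁻¹) ≡ x
    c*[x*c⁻¹] x = trans (solve 3 (λ c x i → c :* (x :* i) := x :* (c :* i)) refl c x c⁻¹)
      (trans (cong (x ℚ.*_) (ℚ.*-inverseʳ c {{ℚ.pos⇒nonZero c}})) (ℚ.*-identityʳ x))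
      where open ℚ-Solver

    x*c*c⁻¹ : ∀ x → x ℚ.* c ℚ.* c⁻¹ ≡ x
    x*c*c⁻¹ x = trans (solve 3 (λ c x i → x :* c :* i := c :* (x :* i)) refl c x c⁻¹) (c*[x*c⁻¹] x)
      where open ℚ-Solver

    c*x≡x/c⁻¹ : ∀ x → c ℚ.* x ≡ x ℚ.* (1/ c⁻¹) {{ℚ.pos⇒nonZero c⁻¹}}
    c*x≡x/c⁻¹ x = begin
      c ℚ.* x                         ≡⟨ cong (c ℚ.*_) (ℚ.*-identityʳ x) ⟨
      c ℚ.* (x ℚ.* 1ℚ)
        ≡⟨ cong (λ z → c ℚ.* (x ℚ.* z)) (ℚ.*-inverseʳ c⁻¹ {{ℚ.pos⇒nonZero c⁻¹}}) ⟨
      c ℚ.* (x ℚ.* (c⁻¹ ℚ.* c⁻¹⁻¹))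
        ≡⟨ solve 4 (λ c x i d → c :* (x :* (i :* d)) := c :* (x :* i) :* d) refl c x c⁻¹ c⁻¹⁻¹ ⟩
      c ℚ.* (x ℚ.* c⁻¹) ℚ.* c⁻¹⁻¹     ≡⟨ cong (ℚ._* c⁻¹⁻¹) (c*[x*c⁻¹] x) ⟩
      x ℚ.* c⁻¹⁻¹                     ∎
      where
      open ≡-Reasoning
      open ℚ-Solver
      c⁻¹⁻¹ = (1/ c⁻¹) {{ℚ.pos⇒nonZero c⁻¹}}

  ι1* : ∀ x → ι 1 ℚ.* x ≡ x
  ι1* x = trans (cong (ℚ._* x) ι-1) (ℚ.*-identityˡ x)

  -- For j > 0: Less x j a says j x < a, and More x j a says a < j x (strict,
  -- because the cuts are open).
  Less More : ℝ → ℕ → ℕ → Set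
  Less x j a = ∃[ y ] upper x y × ι j ℚ.* y ℚ.≤ ι a
  More x j a = ∃[ y ] lower x y × ι a ℚ.≤ ι j ℚ.* y

  ι-*-mono : ∀ j {a b} → a ℚ.≤ b → ι j ℚ.* a ℚ.≤ ι j ℚ.* b
  ι-*-mono j = ℚ.*-monoˡ-≤-nonNeg (ι j)

  ι-*-cancel : ∀ j {a b} → ι (suc j) ℚ.* a ℚ.≤ ι (suc j) ℚ.* b → a ℚ.≤ b
  ι-*-cancel j {a} {b} h = ℚ.*-cancelʳ-≤-pos (ι (suc j))
    (ℚ.≤-trans (ℚ.≤-reflexive (ℚ.*-comm a _)) (ℚ.≤-trans h (ℚ.≤-reflexive (ℚ.*-comm _ b))))

  ι-*-swap : ∀ i j y → ι i ℚ.* (ι j ℚ.* y) ≡ ι j ℚ.* (ι i ℚ.* y)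
  ι-*-swap i j y = solve 3 (λ i j y → i :* (j :* y) := j :* (i :* y)) refl (ι i) (ι j) y
    where open ℚ-Solver

  Less-scale : ∀ x {i j a b} → j * a ≤ suc i * b → Less x (suc i) a → Less x j b
  Less-scale x {i} {j} {a} {b} h (y , uy , le) = y , uy , ι-*-cancel i (begin
    ι (suc i) ℚ.* (ι j ℚ.* y)     ≡⟨ ι-*-swap (suc i) j y ⟩
    ι j ℚ.* (ι (suc i) ℚ.* y)     ≤⟨ ι-*-mono j le ⟩
    ι j ℚ.* ι a                   ≡⟨ ι-* j a ⟨
    ι (j * a)                     ≤⟨ ι-mono-≤ h ⟩
    ι (suc i * b)                 ≡⟨ ι-* (suc i) b ⟩
    ι (suc i) ℚ.* ι b             ∎)
    where open ℚ.≤-Reasoning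

  More-Less : ∀ x {i j a b} → More x (suc i) a → Less x (suc j) b → suc (suc j * a) ≤ suc i * b
  More-Less x {i} {j} {a} {b} (y , ly , a≤) (z , uz , ≤b) = ι-cancel-< (begin-strict
    ι (suc j * a)                       ≡⟨ ι-* (suc j) a ⟩
    ι (suc j) ℚ.* ι a                   ≤⟨ ι-*-mono (suc j) a≤ ⟩
    ι (suc j) ℚ.* (ι (suc i) ℚ.* y)
      <⟨ ℚ.*-monoʳ-<-pos (ι (suc j)) (ℚ.*-monoʳ-<-pos (ι (suc i)) (lower<upper x ly uz)) ⟩
    ι (suc j) ℚ.* (ι (suc i) ℚ.* z)     ≡⟨ ι-*-swap (suc j) (suc i) z ⟩
    ι (suc i) ℚ.* (ι (suc j) ℚ.* z)     ≤⟨ ι-*-mono (suc i) ≤b ⟩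
    ι (suc i) ℚ.* ι b                   ≡⟨ ι-* (suc i) b ⟨
    ι (suc i * b)                       ∎)
    where open ℚ.≤-Reasoning

  -- A cut is located only between two distinct rationals, so exchanging a negated bound for the
  -- opposite one needs a gap between `b` and `a`.
  ¬Less⇒More : ∀ x {a b} → suc b ≤ a → ¬ Less x 1 a → More x 1 b
  ¬Less⇒More x {a} {b} b<a ¬bound = ι b ,
    ¬upper⇒lower x (ι-mono-< b<a) (λ u → ¬bound (ι a , u , ℚ.≤-reflexive (ι1* (ι a)))) ,
    ℚ.≤-reflexive (sym (ι1* (ι b)))

  ¬More⇒Less : ∀ x j {a b} → suc a ≤ b → ¬ More x (suc j) a → Less x (suc j) b
  ¬More⇒Less x j {a} {b} a<b ¬bound = ι b ℚ.* c⁻¹ ,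
    ¬lower⇒upper x (ℚ.*-monoˡ-<-pos c⁻¹ (ι-mono-< a<b))
      (λ l → ¬bound (ι a ℚ.* c⁻¹ , l , ℚ.≤-reflexive (sym (c*[x*c⁻¹] (ι a))))) ,
    ℚ.≤-reflexive (c*[x*c⁻¹] (ι b))
    where open Inverse (ι (suc j))

  opaque
    unfolding ι

    fromℕ-lower : ∀ n {q} → lower (fromℕ n) q → q ℚ.< ι n
    fromℕ-lower n = id

    lower-fromℕ : ∀ n {q} → q ℚ.< ι n → lower (fromℕ n) q
    lower-fromℕ n = id

    fromℕ-upper : ∀ n {q} → upper (fromℕ n) q → ι n ℚ.< q
    fromℕ-upper n = id

    upper-fromℕ : ∀ n {q} → ι n ℚ.< q → upper (fromℕ n) q
    upper-fromℕ n = id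

    √-lower-ι : ∀ n {q} → lower (√ n) q → q ℚ.< 0ℚ ⊎ q ℚ.* q ℚ.< ι n
    √-lower-ι n = id

    lower-√-ι : ∀ n {q} → q ℚ.< 0ℚ ⊎ q ℚ.* q ℚ.< ι n → lower (√ n) q
    lower-√-ι n = id

    √-upper-ι : ∀ n {q} → upper (√ n) q → 0ℚ ℚ.< q × ι n ℚ.< q ℚ.* q
    √-upper-ι n = id

    upper-√-ι : ∀ n {q} → 0ℚ ℚ.< q × ι n ℚ.< q ℚ.* q → upper (√ n) q
    upper-√-ι n = id

  square-mono-≤ : ∀ {p q} → 0ℚ ℚ.≤ p → p ℚ.≤ q → p ℚ.* p ℚ.≤ q ℚ.* q
  square-mono-≤ {p} {q} 0≤p p≤q = ℚ.≤-trans
    (ℚ.*-monoˡ-≤-nonNeg p {{ℚ.nonNegative 0≤p}} p≤q)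
    (ℚ.*-monoʳ-≤-nonNeg q {{ℚ.nonNegative (ℚ.≤-trans 0≤p p≤q)}} p≤q)

  square-cancel-< : ∀ {p q} → 0ℚ ℚ.≤ q → p ℚ.* p ℚ.< q ℚ.* q → p ℚ.< q
  square-cancel-< 0≤q pp<qq = ℚ.≰⇒> (λ q≤p → ℚ.<-irrefl refl (ℚ.<-≤-trans pp<qq (square-mono-≤ 0≤q q≤p)))

  square-mono-< : ∀ {p q} → 0ℚ ℚ.≤ p → p ℚ.< q → p ℚ.* p ℚ.< q ℚ.* q
  square-mono-< {p} {q} 0≤p p<q = ℚ.≤-<-trans
    (ℚ.*-monoˡ-≤-nonNeg p {{ℚ.nonNegative 0≤p}} (ℚ.<⇒≤ p<q))
    (ℚ.*-monoˡ-<-pos q {{ℚ.positive (ℚ.≤-<-trans 0≤p p<q)}} p<q)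

  -- The boards have square order, so the root is the natural number `s`. This lemma and the next
  -- three reduce both halves of its cut to comparisons with `ι s`.
  √-lower : ∀ s {q} → lower (√ (s * s)) q → q ℚ.< ι s
  √-lower s {q} l with √-lower-ι (s * s) l
  ... | inj₁ q<0 = ℚ.<-≤-trans q<0 (ι≥0 s)
  ... | inj₂ qq<ss = square-cancel-< (ι≥0 s) (subst (q ℚ.* q ℚ.<_) (ι-* s s) qq<ss)

  lower-√ : ∀ s {q} → q ℚ.< ι s → lower (√ (s * s)) q
  lower-√ s {q} q<s with q ℚ.<? 0ℚ
  ... | yes q<0 = lower-√-ι (s * s) (inj₁ q<0)
  ... | no  q≮0 = lower-√-ι (s * s) (inj₂ (subst (q ℚ.* q ℚ.<_) (sym (ι-* s s)) (square-mono-< (ℚ.≮⇒≥ q≮0) q<s)))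

  √-upper : ∀ s {q} → upper (√ (s * s)) q → ι s ℚ.< q
  √-upper s {q} u with 0<q , ss<qq ← √-upper-ι (s * s) u =
    square-cancel-< (ℚ.<⇒≤ 0<q) (subst (ℚ._< q ℚ.* q) (ι-* s s) ss<qq)

  upper-√ : ∀ s {q} → ι s ℚ.< q → upper (√ (s * s)) q
  upper-√ s {q} s<q = upper-√-ι (s * s)
    (ℚ.≤-<-trans (ι≥0 s) s<q , subst (ℚ._< q ℚ.* q) (sym (ι-* s s)) (square-mono-< (ι≥0 s) s<q))

  -- Asymptotic relations as bounds by natural multiples

  Eventually : (ℕ → Set) → Set
  Eventually A = ∃[ k ] ∀ n → n > k → A n

  Eventually-map : ∀ {A B : ℕ → Set} → (∀ n → A n → B n) → Eventually A → Eventually B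
  Eventually-map A→B (k , h) = k , λ n n>k → A→B n (h n n>k)

  Eventually-× : ∀ {A B : ℕ → Set} → Eventually A → Eventually B → Eventually (λ n → A n × B n)
  Eventually-× (k , h) (l , g) = k + l , λ n n>kl →
    h n (≤-trans (s≤s (m≤m+n k l)) n>kl) , g n (≤-trans (s≤s (m≤n+m l k)) n>kl)

  √N : ℕ → ℝ
  √N n = √ (Graph.order (𝒦² n))

  module _ (f : ℕ → ℝ) where

    O⇒Less : f ∈O √N → ∃[ c ] Eventually (λ n → Less (f n) 1 (c * suc n))
    O⇒Less (c , k , c>0 , h) with c′ , c<c′ ← archimedean c = suc c′ , Eventually-map bound (k , h)
      where
      open Inverse c {{c>0}}
      bound : ∀ n → f n < _·_ c {{c>0}} (√N n) → Less (f n) 1 (suc c′ * suc n)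
      bound n (x , ux , l) = x , ux , (begin
        ι 1 ℚ.* x                   ≡⟨ ι1* x ⟩
        x                           ≡⟨ c*[x*c⁻¹] x ⟨
        c ℚ.* (x ℚ.* c⁻¹)
          ≤⟨ ℚ.*-monoˡ-≤-nonNeg c {{ℚ.pos⇒nonNeg c {{c>0}}}} (ℚ.<⇒≤ (√-lower (suc n) l)) ⟩
        c ℚ.* ι (suc n)             ≤⟨ ℚ.*-monoʳ-≤-nonNeg (ι (suc n)) (ℚ.<⇒≤ c<c′) ⟩
        ι (suc c′) ℚ.* ι (suc n)    ≡⟨ ι-* (suc c′) (suc n) ⟨
        ι (suc c′ * suc n)          ∎)
        where open ℚ.≤-Reasoning

    Less⇒O : ∀ c → Eventually (λ n → Less (f n) 1 (c * suc n)) → f ∈O √N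
    -- `suc c` is positive even if `c` is not, and its surplus over `c` gives the strict inequality
    -- that the open cut of `√N` demands.
    Less⇒O c (k , h) = ι (suc c) , k , ι-pos , λ n n>k → bound n (h n n>k)
      where
      open Inverse (ι (suc c))
      bound : ∀ n → Less (f n) 1 (c * suc n) → f n < ι (suc c) · √N n
      bound n (y , uy , y≤) = y , uy , lower-√ (suc n) (begin-strict
        y ℚ.* c⁻¹                                  ≡⟨ cong (ℚ._* c⁻¹) (ι1* y) ⟨
        ι 1 ℚ.* y ℚ.* c⁻¹                          ≤⟨ ℚ.*-monoʳ-≤-nonNeg c⁻¹ {{ℚ.pos⇒nonNeg c⁻¹}} y≤ ⟩
        ι (c * suc n) ℚ.* c⁻¹
          <⟨ ℚ.*-monoˡ-<-pos c⁻¹ (ι-mono-< (s≤s (m≤n+m (c * suc n) n))) ⟩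
        ι (suc c * suc n) ℚ.* c⁻¹                  ≡⟨ cong (λ z → ι z ℚ.* c⁻¹) (*-comm (suc c) (suc n)) ⟩
        ι (suc n * suc c) ℚ.* c⁻¹                  ≡⟨ cong (ℚ._* c⁻¹) (ι-* (suc n) (suc c)) ⟩
        ι (suc n) ℚ.* ι (suc c) ℚ.* c⁻¹            ≡⟨ x*c*c⁻¹ (ι (suc n)) ⟩
        ι (suc n)                                  ∎)
        where open ℚ.≤-Reasoning

    Ω⇒More : f ∈Ω √N → ∃[ c ] Eventually (λ n → More (f n) (suc c) (suc n))
    Ω⇒More (c , k , c>0 , h) with c′ , c<c′ ← archimedean c = c′ , Eventually-map bound (k , h)
      where
      open Inverse c {{c>0}}
      bound : ∀ n → √N n < _·_ c {{c>0}} (f n) → More (f n) (suc c′) (suc n)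
      bound n (x , u , lx) = x ℚ.* c⁻¹ , lx , (begin
        ι (suc n)                     ≤⟨ ℚ.<⇒≤ (√-upper (suc n) u) ⟩
        x                             ≡⟨ c*[x*c⁻¹] x ⟨
        c ℚ.* (x ℚ.* c⁻¹)
          ≤⟨ ℚ.*-monoʳ-≤-nonNeg (x ℚ.* c⁻¹) {{ℚ.pos⇒nonNeg (x ℚ.* c⁻¹) {{x/c>0}}}} (ℚ.<⇒≤ c<c′) ⟩
        ι (suc c′) ℚ.* (x ℚ.* c⁻¹)    ∎)
        where
        open ℚ.≤-Reasoning
        x/c>0 : Positive (x ℚ.* c⁻¹)
        x/c>0 = ℚ.pos*pos⇒pos x {{ℚ.positive (ℚ.≤-<-trans (ι≥0 (suc n)) (√-upper (suc n) u))}} c⁻¹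

    More⇒Ω : ∀ c → Eventually (λ n → More (f n) (suc c) (suc n)) → f ∈Ω √N
    More⇒Ω c (k , h) = ι (suc c) , k , ι-pos , λ n n>k → bound n (h n n>k)
      where
      open Inverse (ι (suc c))
      bound : ∀ n → More (f n) (suc c) (suc n) → √N n < ι (suc c) · f n
      bound n (y , ly , ≤y) with y′ , y<y′ , ly′ ← Equivalence.to (lower-rounded (f n)) ly =
        y′ ℚ.* ι (suc c) ,
        upper-√ (suc n) (ℚ.≤-<-trans ≤y (subst (ι (suc c) ℚ.* y ℚ.<_) (ℚ.*-comm _ y′) (ℚ.*-monoʳ-<-pos (ι (suc c)) y<y′))) ,
        subst (lower (f n)) (sym (x*c*c⁻¹ y′)) ly′

    ≪⇒Less : ∀ {t} → f ≪ fromℕ ∘ t → ∀ j → Eventually (λ n → Less (f n) (suc j) (t n))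
    ≪⇒Less {t} f≪t j = Eventually-map bound (f≪t c⁻¹)
      where
      open Inverse (ι (suc j))
      bound : ∀ n → f n < c⁻¹ · fromℕ (t n) → Less (f n) (suc j) (t n)
      bound n (x , ux , l) = x , ux , ℚ.<⇒≤ (subst (ℚ._< ι (t n)) (sym (c*x≡x/c⁻¹ x)) (fromℕ-lower (t n) l))

    Less⇒≪ : (∀ n → fromℕ 0 < f n) → ∀ {t} → (∀ j → Eventually (λ n → Less (f n) (suc j) (t n))) → f ≪ fromℕ ∘ t
    Less⇒≪ f>0 {t} h e with j , e⁻¹<j ← archimedean (Inverse.c⁻¹ e) = Eventually-map bound (h j)
      where
      open Inverse e
      bound : ∀ n → Less (f n) (suc j) (t n) → f n < e · fromℕ (t n)
      bound n (y , uy , y≤) with p , 0<p , lp ← f>0 n = y , uy , lower-fromℕ (t n) (begin-strict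
        y ℚ.* c⁻¹            <⟨ ℚ.*-monoʳ-<-pos y {{ℚ.positive y>0}} e⁻¹<j ⟩
        y ℚ.* ι (suc j)      ≡⟨ ℚ.*-comm y _ ⟩
        ι (suc j) ℚ.* y      ≤⟨ y≤ ⟩
        ι (t n)              ∎)
        where
        open ℚ.≤-Reasoning
        y>0 : 0ℚ ℚ.< y
        y>0 = ℚ.≤-<-trans (ι≥0 0) (ℚ.<-trans (fromℕ-upper 0 0<p) (lower<upper (f n) lp uy))

    ≪⇒More : ∀ {t} → fromℕ ∘ t ≪ f → ∀ j → Eventually (λ n → More (f n) 1 (suc j * t n))
    ≪⇒More {t} t≪f j = Eventually-map bound (t≪f c⁻¹)
      where
      open Inverse (ι (suc j))
      bound : ∀ n → fromℕ (t n) < c⁻¹ · f n → More (f n) 1 (suc j * t n)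
      bound n (x , u , lx) = _ , lx , (begin
        ι (suc j * t n)             ≡⟨ ι-* (suc j) (t n) ⟩
        ι (suc j) ℚ.* ι (t n)       ≤⟨ ι-*-mono (suc j) (ℚ.<⇒≤ (fromℕ-upper (t n) u)) ⟩
        ι (suc j) ℚ.* x             ≡⟨ c*x≡x/c⁻¹ x ⟩
        _                           ≡⟨ ι1* _ ⟨
        ι 1 ℚ.* _                   ∎)
        where open ℚ.≤-Reasoning

    More⇒≪ : ∀ {t} → (∀ j → Eventually (λ n → More (f n) 1 (suc j * t n))) → fromℕ ∘ t ≪ f
    More⇒≪ {t} h e with j , e⁻¹<j ← archimedean (Inverse.c⁻¹ e) = Eventually-map bound (h j)
      where
      open Inverse e
      bound : ∀ n → More (f n) 1 (suc j * t n) → fromℕ (t n) < e · f n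
      bound n (y , ly , ≤y) with y′ , y<y′ , ly′ ← Equivalence.to (lower-rounded (f n)) ly =
        y′ ℚ.* e , upper-fromℕ (t n) (begin-strict
          ι (t n)                          ≡⟨ c*[x*c⁻¹] (ι (t n)) ⟨
          e ℚ.* (ι (t n) ℚ.* c⁻¹)
            ≤⟨ ℚ.*-monoˡ-≤-nonNeg e {{ℚ.pos⇒nonNeg e}} (ℚ.*-monoˡ-≤-nonNeg (ι (t n)) (ℚ.<⇒≤ e⁻¹<j)) ⟩
          e ℚ.* (ι (t n) ℚ.* ι (suc j))
            ≡⟨ cong (e ℚ.*_) (trans (ℚ.*-comm (ι (t n)) _) (sym (ι-* (suc j) (t n)))) ⟩
          e ℚ.* ι (suc j * t n)
            ≤⟨ ℚ.*-monoˡ-≤-nonNeg e {{ℚ.pos⇒nonNeg e}} (ℚ.≤-trans ≤y (ℚ.≤-reflexive (ι1* y))) ⟩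
          e ℚ.* y                          <⟨ ℚ.*-monoʳ-<-pos e y<y′ ⟩
          e ℚ.* y′                         ≡⟨ ℚ.*-comm e y′ ⟩
          y′ ℚ.* e                         ∎) ,
        subst (lower (f n)) (sym (x*c*c⁻¹ y′)) ly′
        where open ℚ.≤-Reasoning

  -- Functions outside Θ

  near-0⇒¬near-1 : ∀ p → ℚ.∣ p ℚ.- 0ℚ ∣ ℚ.< ½ → ¬ ℚ.∣ p ℚ.- 1ℚ ∣ ℚ.< ½
  near-0⇒¬near-1 p near0 near1 = ℚ.<-irrefl {1ℚ} refl (ℚ.≤-<-trans
    (subst (ℚ._≤ ℚ.∣ p ℚ.- 0ℚ ∣ ℚ.+ ℚ.∣ p ℚ.- 1ℚ ∣)
      (cong ℚ.∣_∣ (solve 1 (λ p → (p :- con 0ℚ) :- (p :- con 1ℚ) := con 1ℚ) refl p))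
      (ℚ.∣p-q∣≤∣p∣+∣q∣ (p ℚ.- 0ℚ) (p ℚ.- 1ℚ)))
    (ℚ.+-mono-< near0 near1))
    where open ℚ-Solver

  -- Along the selected n, the index j for which Q j n is known tends to infinity.
  module Subsequence (Q : ℕ → ℕ → Set) (often : ∀ j k → ∃[ n ] suc k ≤ n × Q j n) where
    seq : ℕ → ℕ
    seq zero    = proj₁ (often 0 0)
    seq (suc j) = proj₁ (often (suc j) (seq j))

    Selected : ℕ → Set
    Selected n = ∃[ j ] seq j ≡ n

    seq-Q : ∀ j → Q j (seq j)
    seq-Q zero    = proj₂ (proj₂ (often 0 0))
    seq-Q (suc j) = proj₂ (proj₂ (often (suc j) (seq j)))

    seq-suc : ∀ j → suc (seq j) ≤ seq (suc j)
    seq-suc j = proj₁ (proj₂ (often (suc j) (seq j)))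

    j≤seq : ∀ j → j ≤ seq j
    j≤seq zero    = z≤n
    j≤seq (suc j) = ≤-trans (s≤s (j≤seq j)) (seq-suc j)

    seq-mono : ∀ {i j} → i ≤′ j → seq i ≤ seq j
    seq-mono ≤′-refl       = ≤-refl
    seq-mono (≤′-step i≤j) = ≤-trans (seq-mono i≤j) (≤-trans (n≤1+n _) (seq-suc _))

    unbounded : ∀ k → ∃[ n ] k ≤ n × Selected n
    unbounded k = seq k , j≤seq k , k , refl

    strong : ∀ J′ {n} → suc (seq J′) ≤ n → Selected n → ∃[ j ] J′ ≤ j × Q j n
    strong J′ n> (j , refl) = j , ≮⇒≥ (λ j<J′ → <⇒≱ n> (seq-mono (≤⇒≤′ (≤-trans (n≤1+n j) j<J′)))) , seq-Q j

    choose : (a b : ℕ → ℕ) → ℕ → ℕ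
    choose a b n = if does (em {Selected n}) then a n else b n

    choose-selected : ∀ a b {n} → Selected n → choose a b n ≡ a n
    choose-selected a b {n} s with em {Selected n}
    ... | yes _ = refl
    ... | no ¬s = contradiction s ¬s

    choose-elim : ∀ a b (A : ℕ → Set) {n} → (Selected n → A (a n)) → (¬ Selected n → A (b n)) → A (choose a b n)
    choose-elim a b A {n} yes-case no-case with em {Selected n}
    ... | yes s = yes-case s
    ... | no ¬s = no-case ¬s

  -- Chains `suc n < (d + 1) x` with `((d + 1) c + 1) x < t`; the additional 1 keeps the multiplier
  -- positive for `c = 0`.
  pebbles-≥ : ∀ x c d n t → More x (suc d) (suc n) → Less x (suc (suc d * c)) t → c * suc n ≤ t
  pebbles-≥ x c d n t m l = *-cancelˡ-≤ (suc d) (begin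
      suc d * (c * suc n)              ≡⟨ *-assoc (suc d) c (suc n) ⟨
      suc d * c * suc n                ≤⟨ *-monoˡ-≤ (suc n) (n≤1+n (suc d * c)) ⟩
      suc (suc d * c) * suc n          ≤⟨ n≤1+n _ ⟩
      suc (suc (suc d * c) * suc n)    ≤⟨ More-Less x m l ⟩
      suc d * t                        ∎)
      where open ≤-Reasoning

  pebbles-≤ : ∀ x c d n t → Less x 1 (c * suc n) → More x 1 (suc (c * suc d) * t) → suc d * t ≤ suc n
  pebbles-≤ x c d n t l m = conclude c (subst₂ (λ a b → suc a ≤ b)
      (*-identityˡ (suc (c * suc d) * t)) (*-identityˡ (c * suc n)) (More-Less x m l))
    where
    open ≤-Reasoning
    conclude : ∀ c → suc (suc (c * suc d) * t) ≤ c * suc n → suc d * t ≤ suc n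
    conclude zero    ()
    conclude (suc c) h = *-cancelˡ-≤ (suc c) (begin
      suc c * (suc d * t)              ≡⟨ *-assoc (suc c) (suc d) t ⟨
      suc c * suc d * t                ≤⟨ m≤n+m (suc c * suc d * t) t ⟩
      suc (suc c * suc d) * t          ≤⟨ n≤1+n (suc (suc c * suc d) * t) ⟩
      suc (suc (suc c * suc d) * t)    ≤⟨ h ⟩
      suc c * suc n                    ∎)

  frequently : (A : ℕ → Set) → ¬ Eventually A → ∀ k → ∃[ n ] suc k ≤ n × ¬ A n
  frequently A ¬ev k = decidable-stable em (λ none →
    ¬ev (k , λ n n>k → decidable-stable em (λ ¬An → none (n , n>k , ¬An))))

  -- One factor 2 of the 4 covers the rounding of the quotient, which is at least 1 by `d ≤ n`; the
  -- other replaces `suc (suc n)` by `2 * suc n`.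
  division-bound : ∀ d j j′ n → 4 * suc d * suc j ≤ j′ → d ≤ n →
    suc j * suc (suc n) ≤ suc j′ * (suc n / suc d)
  division-bound d j j′ n J′≤j′ d≤n = begin
    suc j * suc (suc n)                     ≤⟨ *-monoʳ-≤ (suc j) (s≤s (m≤n+m (suc n) n)) ⟩
    suc j * (suc n + suc n)                 ≤⟨ *-monoʳ-≤ (suc j) (+-mono-≤ n≤ n≤) ⟩
    suc j * (a * D + a * D + (a * D + a * D))
      ≡⟨ solve 3 (λ j a D → j :* (a :* D :+ a :* D :+ (a :* D :+ a :* D)) :=
                                                 con 4 :* D :* j :* a) refl (suc j) a D ⟩
    4 * D * suc j * a                       ≤⟨ *-monoˡ-≤ a (≤-trans J′≤j′ (n≤1+n j′)) ⟩
    suc j′ * a                              ∎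
    where
    open ≤-Reasoning
    open +-*-Solver
    D = suc d
    a = suc n / D
    n≤ : suc n ≤ a * D + a * D
    n≤ = begin
      suc n                 ≡⟨ m≡m%n+[m/n]*n (suc n) D ⟩
      suc n % D + a * D     ≤⟨ +-monoˡ-≤ (a * D) (≤-trans (n≤1+n _) (m%n<n (suc n) D)) ⟩
      D + a * D             ≤⟨ +-monoˡ-≤ (a * D) (m≤n*m D a {{>-nonZero (m≥n⇒m/n>0 (s≤s d≤n))}}) ⟩
      a * D + a * D         ∎

  -- If `f` reaches every multiple of `n` infinitely often, `c * n` is negligible against it along a
  -- subsequence. Elsewhere `t` is 0, negligible because `f` is positive.
  sparse-below : (f : ℕ → ℝ) → (∀ n → fromℕ 0 < f n) →
    (∀ c → ¬ Eventually (λ n → Less (f n) 1 (c * suc n))) → ∀ c →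
    ∃[ t ] (∀ j → Eventually (λ n → More (f n) 1 (suc j * t n))) ×
           (∀ k → ∃[ n ] k ≤ n × c * suc n ≤ t n)
  sparse-below f f>0 ¬less c = t , t≪f , λ k → let n , k≤n , s = unbounded k in
    n , k≤n , ≤-reflexive (sym (choose-selected (λ n → c * suc n) (λ _ → 0) s))
    where
    open Subsequence (λ j n → ¬ Less (f n) 1 (j * suc n))
      (λ j → frequently (λ n → Less (f n) 1 (j * suc n)) (¬less j))

    t : ℕ → ℕ
    t = choose (λ n → c * suc n) (λ _ → 0)

    -- One spare multiple of `suc n` provides the gap for `¬Less⇒More`.
    slow : ∀ j j′ n → suc (suc j * c) ≤ j′ → suc (suc j * (c * suc n)) ≤ j′ * suc n
    slow j j′ n J≤j′ = ≤-trans
      (s≤s (≤-trans (≤-reflexive (sym (*-assoc (suc j) c (suc n)))) (m≤n+m (suc j * c * suc n) n)))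
      (*-monoˡ-≤ (suc n) J≤j′)

    on : ∀ j n → n > seq (suc (suc j * c)) → Selected n → More (f n) 1 (suc j * (c * suc n))
    on j n n> s = let j′ , J≤j′ , ¬less = strong (suc (suc j * c)) n> s in
      ¬Less⇒More (f n) (slow j j′ n J≤j′) ¬less

    off : ∀ j n → More (f n) 1 (suc j * 0)
    off j n = let y , 0<y , ly = f>0 n in y , ly , (begin
      ι (suc j * 0)   ≡⟨ cong ι (*-zeroʳ (suc j)) ⟩
      ι 0             ≤⟨ ℚ.<⇒≤ (fromℕ-upper 0 0<y) ⟩
      y               ≡⟨ ι1* y ⟨
      ι 1 ℚ.* y       ∎)
      where open ℚ.≤-Reasoning

    t≪f : ∀ j → Eventually (λ n → More (f n) 1 (suc j * t n))
    t≪f j = seq (suc (suc j * c)) , λ n n> →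
      choose-elim (λ n → c * suc n) (λ _ → 0) (λ u → More (f n) 1 (suc j * u)) {n} (on j n n>) (λ _ → off j n)

  -- If `f` drops to every fraction of `n` infinitely often, `n / (d + 1)` rounded down dominates it
  -- along a subsequence. Elsewhere `t` must dominate `f` too: `high n` exceeds `n + 1` times a
  -- rational upper bound of `f n`.
  sparse-above : (f : ℕ → ℝ) → (∀ c → ¬ Eventually (λ n → More (f n) (suc c) (suc n))) → ∀ d →
    ∃[ t ] (∀ j → Eventually (λ n → Less (f n) (suc j) (t n))) ×
           (∀ k → ∃[ n ] k ≤ n × suc d * t n ≤ suc n)
  sparse-above f ¬more d = t , f≪t , λ k → let n , k≤n , s = unbounded k in
    n , k≤n , (begin
      suc d * t n             ≡⟨ cong (suc d *_) (choose-selected low high s) ⟩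
      suc d * low n           ≡⟨ *-comm (suc d) (low n) ⟩
      low n * suc d           ≤⟨ m/n*n≤m (suc n) (suc d) ⟩
      suc n                   ∎)
    where
    open ≤-Reasoning
    open Subsequence (λ j n → ¬ More (f n) (suc j) (suc n))
      (λ j → frequently (λ n → More (f n) (suc j) (suc n)) (¬more j))

    bound : ∀ n → ∃[ T ] ι (suc n) ℚ.* proj₁ (upper-inhab (f n)) ℚ.< ι (suc T)
    bound n = archimedean (ι (suc n) ℚ.* proj₁ (upper-inhab (f n)))

    low high t J′ : ℕ → ℕ
    low n  = suc n / suc d
    high n = suc (proj₁ (bound n))
    t      = choose low high
    J′ j   = 4 * suc d * suc j

    less-high : ∀ n → Less (f n) (suc n) (high n)
    less-high n = proj₁ (upper-inhab (f n)) , proj₂ (upper-inhab (f n)) , ℚ.<⇒≤ (proj₂ (bound n))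

    on : ∀ j n → n > seq (J′ j) + (j + d) → Selected n → Less (f n) (suc j) (low n)
    on j n n> s = let j′ , J≤j′ , ¬more = strong (J′ j) (≤-trans (s≤s (m≤m+n (seq (J′ j)) (j + d))) n>) s in
      Less-scale (f n) (division-bound d j j′ n J≤j′
        (≤-trans (m≤n+m d j) (≤-trans (m≤n+m (j + d) (seq (J′ j))) (≤-trans (n≤1+n _) n>))))
        (¬More⇒Less (f n) j′ ≤-refl ¬more)

    off : ∀ j n → n > seq (J′ j) + (j + d) → Less (f n) (suc j) (high n)
    off j n n> = Less-scale (f n) (*-monoˡ-≤ (high n)
      (≤-trans (s≤s (≤-trans (m≤m+n j d) (m≤n+m (j + d) (seq (J′ j))))) (≤-trans n> (n≤1+n n))))
      (less-high n)

    f≪t : ∀ j → Eventually (λ n → Less (f n) (suc j) (t n))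
    -- `seq (J′ j)` makes the index of the subsequence large, `d` keeps the quotient positive, and
    -- `j` is what `high` needs.
    f≪t j = seq (J′ j) + (j + d) , λ n n> →
      choose-elim low high (Less (f n) (suc j)) {n} (on j n n>) (λ _ → off j n n>)

  -- The threshold criterion

  module Criterion (p : ℕ → ℕ → ℚ)
    (near-0 : ∀ e .{{_ : ℚ.Positive e}} → ∃[ d ] ∀ n t → suc d * t ≤ suc n → ℚ.∣ p n t ℚ.- 0ℚ ∣ ℚ.< e)
    (near-1 : ∀ e .{{_ : ℚ.Positive e}} → ∃[ c ] ∃[ k ] ∀ n → k ≤ suc n → ∀ t → c * suc n ≤ t →
      ℚ.∣ p n t ℚ.- 1ℚ ∣ ℚ.< e)
    (f : ℕ → ℝ) (f>0 : ∀ n → fromℕ 0 < f n) where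

    Threshold : Set
    Threshold = (∀ (t : ℕ → ℕ) → f ≪ fromℕ ∘ t → (λ n → p n (t n)) ⟶ 1ℚ)
        × (∀ (t : ℕ → ℕ) → fromℕ ∘ t ≪ f → (λ n → p n (t n)) ⟶ 0ℚ)

    Θ⇒threshold : f ∈Θ √N → Threshold
    Θ⇒threshold (f∈O , f∈Ω) = above , below
      where
      above : ∀ t → f ≪ fromℕ ∘ t → (λ n → p n (t n)) ⟶ 1ℚ
      above t f≪t e = k + l , holds
        where
        c = proj₁ (near-1 e)
        k = proj₁ (proj₂ (near-1 e))
        d = proj₁ (Ω⇒More f f∈Ω)

        ev : Eventually (λ n → More (f n) (suc d) (suc n) × Less (f n) (suc (suc d * c)) (t n))
        ev = Eventually-× (proj₂ (Ω⇒More f f∈Ω)) (≪⇒Less f {t} f≪t (suc d * c))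
        l = proj₁ ev

        holds : ∀ n → n > k + l → ℚ.∣ p n (t n) ℚ.- 1ℚ ∣ ℚ.< e
        holds n n> = proj₂ (proj₂ (near-1 e)) n
          (≤-trans (m≤m+n k l) (≤-trans (n≤1+n (k + l)) (≤-trans n> (n≤1+n n)))) (t n)
          (pebbles-≥ (f n) c d n (t n) (proj₁ both) (proj₂ both))
          where both = proj₂ ev n (≤-trans (s≤s (m≤n+m l k)) n>)

      below : ∀ t → fromℕ ∘ t ≪ f → (λ n → p n (t n)) ⟶ 0ℚ
      below t t≪f e = proj₁ ev , holds
        where
        c = proj₁ (O⇒Less f f∈O)
        d = proj₁ (near-0 e)

        ev : Eventually (λ n → Less (f n) 1 (c * suc n) × More (f n) 1 (suc (c * suc d) * t n))
        ev = Eventually-× (proj₂ (O⇒Less f f∈O)) (≪⇒More f {t} t≪f (c * suc d))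

        holds : ∀ n → n > proj₁ ev → ℚ.∣ p n (t n) ℚ.- 0ℚ ∣ ℚ.< e
        holds n n> = proj₂ (near-0 e) n (t n) (pebbles-≤ (f n) c d n (t n) (proj₁ both) (proj₂ both))
          where both = proj₂ ev n n>

    -- Otherwise some `t ≪ f` still reaches `c * n` infinitely often: the threshold brings the
    -- probability within ½ of 0, `near-1` within ½ of 1, and both cannot hold. `threshold⇒Ω` is the
    -- mirror image.
    threshold⇒O : Threshold → f ∈O √N
    threshold⇒O (_ , below) = decidable-stable em λ f∉O →
      let t , t≪f , large = sparse-below f f>0 (λ c ev → f∉O (Less⇒O f c ev)) c
      in refute t (More⇒≪ f {t} t≪f) large
      where
      c = proj₁ (near-1 ½)
      k = proj₁ (proj₂ (near-1 ½))

      refute : ∀ t → fromℕ ∘ t ≪ f → (∀ k → ∃[ n ] k ≤ n × c * suc n ≤ t n) → ⊥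
      refute t t≪f large = let l , near0 = below t t≪f ½
                               n , n≥ , cn≤t = large (k + suc l)
        in near-0⇒¬near-1 (p n (t n)) (near0 n (≤-trans (m≤n+m (suc l) k) n≥))
             (proj₂ (proj₂ (near-1 ½)) n (≤-trans (m≤m+n k (suc l)) (≤-trans n≥ (n≤1+n n))) (t n) cn≤t)

    threshold⇒Ω : Threshold → f ∈Ω √N
    threshold⇒Ω (above , _) = decidable-stable em λ f∉Ω →
      let t , f≪t , small = sparse-above f (λ c ev → f∉Ω (More⇒Ω f c ev)) d
      in refute t (Less⇒≪ f f>0 {t} f≪t) small
      where
      d = proj₁ (near-0 ½)

      refute : ∀ t → f ≪ fromℕ ∘ t → (∀ k → ∃[ n ] k ≤ n × suc d * t n ≤ suc n) → ⊥
      refute t f≪t small = let k , near1 = above t f≪t ½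
                               n , n> , dt≤n = small (suc k)
        in near-0⇒¬near-1 (p n (t n)) (proj₂ (near-0 ½) n (t n) dt≤n) (near1 n n>)

theorem4 : ExcludedMiddle 0ℓ →
    (f : ℕ → ℝ) → (∀ n → fromℕ 0 < f n) →
    IsThreshold 𝒦² f ⇔ f ∈Θ (λ n → √ (Graph.order (𝒦² n)))
theorem4 em f f>0 = mk⇔ to from
  where
  open Criterion em (P 𝒦²) (P-near-0 em) (P-near-1 em) f f>0

  to : IsThreshold 𝒦² f → f ∈Θ (λ n → √ (Graph.order (𝒦² n)))
  to h = threshold⇒O h , threshold⇒Ω h

  from : f ∈Θ (λ n → √ (Graph.order (𝒦² n))) → IsThreshold 𝒦² f
  from = Θ⇒threshold
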